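{- Let $(\mathbf A,G,H)$ be a tense Pavelka algebra whose underlying Pavelka algebra $\mathbf A$ is semisimple, and let $R\colon\mathrm{Spec_M}\mathbf A\times\mathrm{Spec_M}\mathbf A\to[0,1]$, $R(F,F')=\bigwedge_{a\in A}(G(a)/F'\rightarrow a/F)$, be its natural time frame relation. Then: (i) $R$ is reflexive if and only if $G(x)\le x$ for all $x\in A$ (equivalently, if and only if $H(x)\le x$ for all $x\in A$); (ii) $R$ is symmetric if and only if $H=G$; (iii) $R$ is transitive if and only if $G(x)\le G(G(x))$ for all $x\in A$ (equivalently, if and only if $H(x)\le H(H(x))$ for all $x\in A$).
   Context: An MV-algebra $(A;\oplus,\neg,0)$ carries derived operations $1=\neg0$, $x\cdot y=\neg(\neg x\oplus\neg y)$, $x\rightarrow y=\neg x\oplus y$, $x\wedge y$, $x\vee y$ (lattice operations of the order $x\le y$ iff $\neg x\oplus y=1$). The standard MV-algebra is $[0,1]$ with $x\oplus y=\min\{x+y,1\}$, $\neg x=1-x$. A Pavelka algebra is $\mathbf A=(A;\oplus,\neg,\{\mathbf r\mid r\in[0,1]\cap\mathbb Q\})$ with $(A;\oplus,\neg,\mathbf 0)$ an MV-algebra, $\mathbf r\oplus\mathbf s=\mathbf t$ whenever $\min\{r+s,1\}=t$, $\neg\mathbf r=\mathbf s$ whenever $1-r=s$. Filters are filters of the MV-reduct; $\mathrm{Spec_M}\mathbf A$ is the set of maximal proper filters; $\mathbf A/F$ embeds uniquely into $[0,1]$ and $x/F$ is identified with its image. Semisimple: MV-reduct is a subdirect product of simple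 MV-algebras. A tense Pavelka algebra is $(\mathbf A,G,H)$ with $G,H\colon A\to A$ such that for all $x,y$ and constants $\mathbf r$: (PT1) $G(x\wedge y)=G(x)\wedge G(y)$, $H(x\wedge y)=H(x)\wedge H(y)$; (PT2) $\mathbf r\rightarrow G(x)=G(\mathbf r\rightarrow x)$, $\mathbf r\rightarrow H(x)=H(\mathbf r\rightarrow x)$; (PT3) $\neg H(\neg G(x))\le x$, $\neg G(\neg H(x))\le x$. A fuzzy relation $R\colon T\times T\to[0,1]$ is reflexive if $R(t,t)=1$, symmetric if $R(s,t)=R(t,s)$, transitive if $R(s,t)\cdot R(t,u)\le R(s,u)$ for all $s,t,u$. -}

module Defs where

open import Level using (Level; Lift; lift; lower; _⊔_; Setω) renaming (suc to lsuc)
open import Algebra.Structures using (IsCommutativeMonoid)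
open import Axiom.ExcludedMiddle using (ExcludedMiddle)
open import Data.Empty using (⊥; ⊥-elim)
open import Data.Integer as ℤ using (+_; -[1+_])
import Data.Integer.Properties as ℤ
open import Data.Nat as ℕ using (ℕ; zero; suc)
import Data.Nat.Properties as ℕ
import Data.Nat.Coprimality as ℕ
open import Data.Product using (Σ; Σ-syntax; ∃; ∃-syntax; _×_; _,_; proj₁; proj₂)
open import Data.Rational as ℚ using (ℚ; mkℚ; 0ℚ; 1ℚ; ½; _+_; _*_; _-_; _≤_; _<_; _⊓_)
import Data.Rational.Properties as ℚ
open import Data.Rational.Solver using (module +-*-Solver)
open import Data.Sum using (_⊎_; inj₁; inj₂)
open import Relation.Binary using (Rel; IsEquivalence; Poset)
open import Relation.Binary.PropositionalEquality using (_≡_; refl; sym; trans; cong; subst)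
open import Relation.Nullary using (¬_; Dec; yes; no)
open import Relation.Unary using (Pred)

-- Excluded middle and Zorn's lemma make up the classical background theory: they
-- are assumed as hypotheses because neither is provable here.

EM : Setω
EM = ∀ {ℓ} → ExcludedMiddle ℓ

module _ {a ℓ₁ ℓ₂} (P : Poset a ℓ₁ ℓ₂) where
  open Poset P renaming (_≤_ to _≼_)

  IsChain : ∀ {p} → Pred Carrier p → Set (a ⊔ ℓ₂ ⊔ p)
  IsChain C = ∀ {x y} → C x → C y → x ≼ y ⊎ y ≼ x

  HasUpperBound : ∀ {p} → Pred Carrier p → Set (a ⊔ ℓ₂ ⊔ p)
  HasUpperBound C = ∃[ u ] (∀ {x} → C x → x ≼ u)

  IsMaximal : Pred Carrier (a ⊔ ℓ₁ ⊔ ℓ₂)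
  IsMaximal m = ∀ {x} → m ≼ x → x ≈ m

ZornsLemma : Setω
ZornsLemma = ∀ {a ℓ₁ ℓ₂ p} (P : Poset a ℓ₁ ℓ₂) →
  (∀ (C : Pred (Poset.Carrier P) p) → IsChain P C → HasUpperBound P C) →
  ∃ (IsMaximal P)

by-contradiction : EM → ∀ {a} {P : Set a} → ¬ ¬ P → P
by-contradiction em {P = P} ¬¬p with em {P = P}
... | yes p = p
... | no ¬p = ⊥-elim (¬¬p ¬p)

module ℚ-Lemmas where
  open +-*-Solver

  0<⇒< : ∀ {p q d} → 0ℚ < d → d ≡ q - p → p < q
  0<⇒< {p} {q} {d} 0<d d≡ = begin-strict
    p            ≡⟨ ℚ.+-identityˡ p ⟨
    0ℚ + p       <⟨ ℚ.+-monoˡ-< p 0<d ⟩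
    d + p        ≡⟨ cong (_+ p) d≡ ⟩
    (q - p) + p  ≡⟨ solve 2 (λ p q → (q :- p) :+ p := q) refl p q ⟩
    q            ∎
    where open ℚ.≤-Reasoning

  0≤⇒≤ : ∀ {p q d} → 0ℚ ≤ d → d ≡ q - p → p ≤ q
  0≤⇒≤ {p} {q} {d} 0≤d d≡ = begin
    p            ≡⟨ ℚ.+-identityˡ p ⟨
    0ℚ + p       ≤⟨ ℚ.+-monoˡ-≤ p 0≤d ⟩
    d + p        ≡⟨ cong (_+ p) d≡ ⟩
    (q - p) + p  ≡⟨ solve 2 (λ p q → (q :- p) :+ p := q) refl p q ⟩
    q            ∎
    where open ℚ.≤-Reasoning

  <⇒0< : ∀ {p q} → p < q → 0ℚ < q - p
  <⇒0< {p} {q} p<q = subst (_< q - p) (ℚ.+-inverseʳ p) (ℚ.+-monoˡ-< (ℚ.- p) p<q)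

  ≤⇒0≤ : ∀ {p q} → p ≤ q → 0ℚ ≤ q - p
  ≤⇒0≤ {p} {q} p≤q = subst (_≤ q - p) (ℚ.+-inverseʳ p) (ℚ.+-monoˡ-≤ (ℚ.- p) p≤q)

  0<+0≤ : ∀ {p q} → 0ℚ < p → 0ℚ ≤ q → 0ℚ < p + q
  0<+0≤ = ℚ.+-mono-<-≤

  0<+0< : ∀ {p q} → 0ℚ < p → 0ℚ < q → 0ℚ < p + q
  0<+0< = ℚ.+-mono-<

  0≤+0≤ : ∀ {p q} → 0ℚ ≤ p → 0ℚ ≤ q → 0ℚ ≤ p + q
  0≤+0≤ = ℚ.+-mono-≤

  0<1 : 0ℚ < 1ℚ
  0<1 = ℚ.positive⁻¹ 1ℚ

  0≤1 : 0ℚ ≤ 1ℚ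
  0≤1 = ℚ.<⇒≤ 0<1

  -1<0 : ℚ.- 1ℚ < 0ℚ
  -1<0 = ℚ.negative⁻¹ (ℚ.- 1ℚ)

  <-contra : ∀ {a} {A : Set a} {p q} → p < q → q ≤ p → A
  <-contra p<q q≤p = ⊥-elim (ℚ.<-irrefl refl (ℚ.<-≤-trans p<q q≤p))

  halve : ∀ {d} → 0ℚ < d → ∃[ h ] (0ℚ < h × h + h ≡ d)
  halve {d} 0<d = ½ * d , ℚ.positive⁻¹ (½ * d) {{ℚ.pos*pos⇒pos ½ d {{ℚ.positive 0<d}}}} ,
    trans (sym (ℚ.*-distribʳ-+ d ½ ½)) (ℚ.*-identityˡ d)

  quarter : ∀ {d} → 0ℚ < d → ∃[ e ] (0ℚ < e × d ≡ (e + e) + (e + e))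
  quarter 0<d =
    let (h , 0<h , h+h≡d) = halve 0<d
        (e , 0<e , e+e≡h) = halve 0<h
    in e , 0<e , trans (sym h+h≡d) (cong (λ z → z + z) (sym e+e≡h))

  fromℕ : ℕ → ℚ
  fromℕ n = mkℚ (+ n) 0 (ℕ.sym (ℕ.1-coprimeTo n))

  fromℕ-suc : ∀ n → fromℕ (suc n) ≡ fromℕ n + 1ℚ
  fromℕ-suc n = sym (trans
    (cong (λ m → (m ℤ.+ + 1) ℚ./ 1) (ℤ.*-identityʳ (+ n)))
    (trans (cong (λ k → + k ℚ./ 1) (ℕ.+-comm n 1))
           (ℚ.normalize-coprime (ℕ.sym (ℕ.1-coprimeTo (suc n))))))

  <fromℕ : ∀ x → ∃[ n ] x < fromℕ n
  <fromℕ (mkℚ (+ n) d _) = suc n , ℚ.*<* (ℤ.<-≤-trans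
    (subst (ℤ._< + suc n) (sym (ℤ.*-identityʳ (+ n))) (ℤ.+<+ (ℕ.n<1+n n)))
    (subst (+ suc n ℤ.≤_) (ℤ.pos-* (suc n) (suc d)) (ℤ.+≤+ (ℕ.m≤m*n (suc n) (suc d)))))
  <fromℕ (mkℚ -[1+ n ] d _) = 0 , ℚ.*<* ℤ.-<+

  -- A set of rationals closed under adding some δ > 0 is unbounded.
  unbounded : ∀ {ℓ} (P : Pred ℚ ℓ) {a δ} → 0ℚ < δ → P a →
              (∀ {x} → P x → P (x + δ)) → ∀ b → ∃[ x ] (P x × b < x)
  unbounded P {a} {δ} 0<δ Pa step b = a + fromℕ n * δ , iter n , b<
    where
    instance
      δ-pos : ℚ.Positive δ
      δ-pos = ℚ.positive 0<δ
      δ-nz : ℚ.NonZero δ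
      δ-nz = ℚ.pos⇒nonZero δ

    n : ℕ
    n = proj₁ (<fromℕ ((b - a) * (ℚ.1/ δ)))

    iter : ∀ k → P (a + fromℕ k * δ)
    iter zero    = subst P (sym (trans (cong (λ z → a + z) (ℚ.*-zeroˡ δ)) (ℚ.+-identityʳ a))) Pa
    iter (suc k) = subst P
      (trans (solve 3 (λ a k d → (a :+ k :* d) :+ d := a :+ (k :+ con 1ℚ) :* d) refl a (fromℕ k) δ)
             (cong (λ z → a + z * δ) (sym (fromℕ-suc k))))
      (step (iter k))

    b-a≡ : ((b - a) * (ℚ.1/ δ)) * δ ≡ b - a
    b-a≡ = trans (ℚ.*-assoc (b - a) (ℚ.1/ δ) δ)
             (trans (cong ((b - a) *_) (ℚ.*-inverseˡ δ)) (ℚ.*-identityʳ (b - a)))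

    b< : b < a + fromℕ n * δ
    b< = 0<⇒< (<⇒0< (subst (_< fromℕ n * δ) b-a≡
                  (ℚ.*-monoˡ-<-pos δ (proj₂ (<fromℕ ((b - a) * (ℚ.1/ δ)))))))
               (solve 3 (λ a b m → m :- (b :- a) := (a :+ m) :- b) refl a b (fromℕ n * δ))

record RawMVAlgebra c ℓ : Set (lsuc (c ⊔ ℓ)) where
  infix  4 _≈_ _⊑_
  infixl 6 _⊕_
  infixl 7 _·_
  infix  8 ~_
  infixr 5 _⇒_
  infixl 6 _∧_ _∨_
  field
    Carrier : Set c
    _≈_     : Rel Carrier ℓ
    _⊕_     : Carrier → Carrier → Carrier
    ~_      : Carrier → Carrier
    0#      : Carrier

  1# : Carrier
  1# = ~ 0#

  _·_ _⇒_ _∨_ _∧_ : Carrier → Carrier → Carrier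
  x · y = ~ (~ x ⊕ ~ y)
  x ⇒ y = ~ x ⊕ y
  x ∨ y = ~ (~ x ⊕ y) ⊕ y
  x ∧ y = ~ (~ x ∨ ~ y)

  _⊑_ : Rel Carrier ℓ
  x ⊑ y = ~ x ⊕ y ≈ 1#

-- One universe level for carrier and equality, so that an algebra and its
-- quotients by filters are of the same size.
record MVAlgebra ℓ : Set (lsuc ℓ) where
  field
    raw : RawMVAlgebra ℓ ℓ
  open RawMVAlgebra raw public
  field
    isCommutativeMonoid : IsCommutativeMonoid _≈_ _⊕_ 0#
    ~-cong       : ∀ {x y} → x ≈ y → ~ x ≈ ~ y
    ~-involutive : ∀ x → ~ ~ x ≈ x
    ⊕-zeroʳ      : ∀ x → x ⊕ ~ 0# ≈ ~ 0#
    łukasiewicz  : ∀ x y → ~ (~ x ⊕ y) ⊕ y ≈ ~ (~ y ⊕ x) ⊕ x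

  open IsCommutativeMonoid isCommutativeMonoid public
    using (isEquivalence; setoid)
    renaming (∙-cong to ⊕-cong; assoc to ⊕-assoc; comm to ⊕-comm;
              identityˡ to ⊕-identityˡ; identityʳ to ⊕-identityʳ)
  open IsEquivalence isEquivalence public
    renaming (refl to ≈-refl; sym to ≈-sym; trans to ≈-trans)

module MVProperties {ℓ} (𝔸 : MVAlgebra ℓ) where
  open MVAlgebra 𝔸
  import Relation.Binary.Reasoning.Setoid as SetoidReasoning
  open SetoidReasoning (IsCommutativeMonoid.setoid isCommutativeMonoid)

  ⊕-congˡ : ∀ {x y z} → y ≈ z → x ⊕ y ≈ x ⊕ z
  ⊕-congˡ = ⊕-cong ≈-refl

  ⊕-congʳ : ∀ {x y z} → y ≈ z → y ⊕ x ≈ z ⊕ x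
  ⊕-congʳ e = ⊕-cong e ≈-refl

  ⊕-zeroˡ : ∀ x → 1# ⊕ x ≈ 1#
  ⊕-zeroˡ x = ≈-trans (⊕-comm 1# x) (⊕-zeroʳ x)

  ~1≈0 : ~ 1# ≈ 0#
  ~1≈0 = ~-involutive 0#

  ~x⊕x≈1 : ∀ x → ~ x ⊕ x ≈ 1#
  ~x⊕x≈1 x = begin
    ~ x ⊕ x                ≈⟨ ⊕-congʳ (~-cong (≈-trans (⊕-congʳ ~1≈0) (⊕-identityˡ x))) ⟨
    ~ (~ 1# ⊕ x) ⊕ x       ≈⟨ łukasiewicz 1# x ⟩
    ~ (~ x ⊕ 1#) ⊕ 1#      ≈⟨ ⊕-zeroʳ _ ⟩
    1#                     ∎

  ⊑-reflexive : ∀ {x y} → x ≈ y → x ⊑ y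
  ⊑-reflexive {x} {y} e = ≈-trans (⊕-congˡ (≈-sym e)) (~x⊕x≈1 x)

  ⊑-refl : ∀ {x} → x ⊑ x
  ⊑-refl = ⊑-reflexive ≈-refl

  ⊑⇒∨ : ∀ {x y} → x ⊑ y → x ∨ y ≈ y
  ⊑⇒∨ {x} {y} x⊑y = begin
    ~ (~ x ⊕ y) ⊕ y  ≈⟨ ⊕-congʳ (~-cong x⊑y) ⟩
    ~ 1# ⊕ y         ≈⟨ ⊕-congʳ ~1≈0 ⟩
    0# ⊕ y           ≈⟨ ⊕-identityˡ y ⟩
    y                ∎

  ⊑-antisym : ∀ {x y} → x ⊑ y → y ⊑ x → x ≈ y
  ⊑-antisym {x} {y} p q = begin
    x      ≈⟨ ⊑⇒∨ q ⟨
    y ∨ x  ≈⟨ łukasiewicz y x ⟩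
    x ∨ y  ≈⟨ ⊑⇒∨ p ⟩
    y      ∎

  x⊑x⊕y : ∀ {x y} → x ⊑ x ⊕ y
  x⊑x⊕y {x} {y} = begin
    ~ x ⊕ (x ⊕ y)  ≈⟨ ⊕-assoc _ _ _ ⟨
    (~ x ⊕ x) ⊕ y  ≈⟨ ⊕-congʳ (~x⊕x≈1 x) ⟩
    1# ⊕ y         ≈⟨ ⊕-zeroˡ y ⟩
    1#             ∎

  -- The order is the natural order of the monoid.
  ⊑⇒⊕ : ∀ {x y} → x ⊑ y → ∃[ z ] y ≈ x ⊕ z
  ⊑⇒⊕ {x} {y} p = ~ (~ y ⊕ x) ,
    ≈-trans (≈-sym (⊑⇒∨ p)) (≈-trans (łukasiewicz x y) (⊕-comm _ x))

  ⊕⇒⊑ : ∀ {x y z} → y ≈ x ⊕ z → x ⊑ y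
  ⊕⇒⊑ {x} {y} {z} e = ≈-trans (⊕-congˡ e) x⊑x⊕y

  ⊑-trans : ∀ {x y z} → x ⊑ y → y ⊑ z → x ⊑ z
  ⊑-trans p q with ⊑⇒⊕ p | ⊑⇒⊕ q
  ... | u , e | v , f = ⊕⇒⊑ (≈-trans f (≈-trans (⊕-congʳ e) (⊕-assoc _ u v)))

  ⊕-monoˡ : ∀ {x y} z → x ⊑ y → x ⊕ z ⊑ y ⊕ z
  ⊕-monoˡ {x} {y} z p with ⊑⇒⊕ p
  ... | u , e = ⊕⇒⊑ (begin
    y ⊕ z        ≈⟨ ⊕-congʳ e ⟩
    (x ⊕ u) ⊕ z  ≈⟨ ⊕-assoc x u z ⟩
    x ⊕ (u ⊕ z)  ≈⟨ ⊕-congˡ (⊕-comm u z) ⟩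
    x ⊕ (z ⊕ u)  ≈⟨ ⊕-assoc x z u ⟨
    (x ⊕ z) ⊕ u  ∎)

  ⊕-mono : ∀ {x y z w} → x ⊑ y → z ⊑ w → x ⊕ z ⊑ y ⊕ w
  ⊕-mono {x} {y} {z} {w} p q = ⊑-trans (⊕-monoˡ z p)
    (⊑-trans (⊑-reflexive (⊕-comm y z)) (⊑-trans (⊕-monoˡ y q) (⊑-reflexive (⊕-comm w y))))

  ~-anti : ∀ {x y} → x ⊑ y → ~ y ⊑ ~ x
  ~-anti {x} {y} p = begin
    ~ ~ y ⊕ ~ x  ≈⟨ ⊕-congʳ (~-involutive y) ⟩
    y ⊕ ~ x      ≈⟨ ⊕-comm y (~ x) ⟩
    ~ x ⊕ y      ≈⟨ p ⟩
    1#           ∎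

  ·-mono : ∀ {x y z w} → x ⊑ y → z ⊑ w → x · z ⊑ y · w
  ·-mono p q = ~-anti (⊕-mono (~-anti p) (~-anti q))

  ⇒-mono : ∀ {x y z w} → y ⊑ x → z ⊑ w → x ⇒ z ⊑ y ⇒ w
  ⇒-mono p q = ⊕-mono (~-anti p) q

  0⊑ : ∀ {x} → 0# ⊑ x
  0⊑ {x} = ⊕-zeroˡ x

  ⊑1 : ∀ {x} → x ⊑ 1#
  ⊑1 = ⊕-zeroʳ _

  1⊑⇒≈ : ∀ {x} → 1# ⊑ x → x ≈ 1#
  1⊑⇒≈ p = ⊑-antisym ⊑1 p

  ·-comm : ∀ x y → x · y ≈ y · x
  ·-comm x y = ~-cong (⊕-comm (~ x) (~ y))

  ·-cong : ∀ {x y z w} → x ≈ y → z ≈ w → x · z ≈ y · w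
  ·-cong e f = ~-cong (⊕-cong (~-cong e) (~-cong f))

  ·-assoc : ∀ x y z → (x · y) · z ≈ x · (y · z)
  ·-assoc x y z = ~-cong (begin
    ~ ~ (~ x ⊕ ~ y) ⊕ ~ z  ≈⟨ ⊕-congʳ (~-involutive _) ⟩
    (~ x ⊕ ~ y) ⊕ ~ z      ≈⟨ ⊕-assoc _ _ _ ⟩
    ~ x ⊕ (~ y ⊕ ~ z)      ≈⟨ ⊕-congˡ (~-involutive _) ⟨
    ~ x ⊕ ~ ~ (~ y ⊕ ~ z)  ∎)

  x·y⊑x : ∀ {x y} → x · y ⊑ x
  x·y⊑x {x} {y} = ⊑-trans (~-anti x⊑x⊕y) (⊑-reflexive (~-involutive x))

  x·y⊑y : ∀ {x y} → x · y ⊑ y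
  x·y⊑y {x} {y} = ⊑-trans (⊑-reflexive (·-comm x y)) x·y⊑x

  curry≈ : ∀ x y z → ((x · y) ⇒ z) ≈ (x ⇒ y ⇒ z)
  curry≈ x y z = ≈-trans (⊕-congʳ (~-involutive _)) (⊕-assoc _ _ _)

  curry : ∀ {x y z} → x · y ⊑ z → x ⊑ y ⇒ z
  curry p = ≈-trans (≈-sym (curry≈ _ _ _)) p

  uncurry : ∀ {x y z} → x ⊑ y ⇒ z → x · y ⊑ z
  uncurry p = ≈-trans (curry≈ _ _ _) p

  eval : ∀ {x y} → (x ⇒ y) · x ⊑ y
  eval = uncurry ⊑-refl

  contrapose : ∀ x y → (x ⇒ ~ y) ≈ (y ⇒ ~ x)
  contrapose x y = ⊕-comm (~ x) (~ y)

  ∨-ubʳ : ∀ {x y} → y ⊑ x ∨ y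
  ∨-ubʳ {x} {y} = ⊑-trans x⊑x⊕y (⊑-reflexive (⊕-comm y _))

  ∨-ubˡ : ∀ {x y} → x ⊑ x ∨ y
  ∨-ubˡ {x} {y} = ⊑-trans ∨-ubʳ (⊑-reflexive (łukasiewicz y x))

  ∨-lub : ∀ {x y z} → x ⊑ z → y ⊑ z → x ∨ y ⊑ z
  ∨-lub {x} {y} {z} p q = ⊑-trans
    (⊕-monoˡ y (~-anti (⊕-monoˡ y (~-anti p))))
    (⊑-reflexive (≈-trans (łukasiewicz z y) (⊑⇒∨ q)))

  ∧-lbˡ : ∀ {x y} → x ∧ y ⊑ x
  ∧-lbˡ = ⊑-trans (~-anti ∨-ubˡ) (⊑-reflexive (~-involutive _))

  ∧-lbʳ : ∀ {x y} → x ∧ y ⊑ y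
  ∧-lbʳ = ⊑-trans (~-anti ∨-ubʳ) (⊑-reflexive (~-involutive _))

  ∧-glb : ∀ {x y z} → z ⊑ x → z ⊑ y → z ⊑ x ∧ y
  ∧-glb p q = ⊑-trans (⊑-reflexive (≈-sym (~-involutive _)))
                      (~-anti (∨-lub (~-anti p) (~-anti q)))

  ·-∨ : ∀ {x y z w} → x · z ⊑ w → y · z ⊑ w → (x ∨ y) · z ⊑ w
  ·-∨ p q = uncurry (∨-lub (curry p) (curry q))

  divisible : ∀ x y → x · (x ⇒ y) ≈ x ∧ y
  divisible x y = ~-cong (begin
    ~ x ⊕ ~ (~ x ⊕ y)      ≈⟨ ⊕-comm _ _ ⟩
    ~ (~ x ⊕ y) ⊕ ~ x      ≈⟨ ⊕-congʳ (~-cong (≈-trans (⊕-congʳ (~-involutive y)) (⊕-comm y (~ x)))) ⟨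
    ~ (~ ~ y ⊕ ~ x) ⊕ ~ x  ≈⟨ łukasiewicz (~ y) (~ x) ⟩
    ~ x ∨ ~ y              ∎)

  ∧⊑divisible : ∀ {x y z} → z ⊑ x → z ⊑ y → z ⊑ x · (x ⇒ y)
  ∧⊑divisible p q = ⊑-trans (∧-glb p q) (⊑-reflexive (≈-sym (divisible _ _)))

  ~x·x⊑0 : ∀ {x} → ~ x · x ⊑ 0#
  ~x·x⊑0 {x} = uncurry (⊑-reflexive (≈-sym (⊕-identityʳ (~ x))))

  prelinear : ∀ x y → 1# ⊑ (x ⇒ y) ∨ (y ⇒ x)
  prelinear x y = ⊑-trans (~-anti ~[]⊑0) (⊑-reflexive (~-involutive _))
    where
    u v w : Carrier
    u = ~ y · x
    v = ~ x · y
    w = x ⇒ v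

    ~⇒ : ∀ {x y} → ~ (x ⇒ y) ⊑ ~ y · x
    ~⇒ {x} {y} = ⊑-reflexive (~-cong (≈-trans (⊕-comm _ _) (⊕-congʳ (≈-sym (~-involutive y)))))

    u·⊑ : u · (u ⇒ v) ⊑ x · (~ y · (~ y ⇒ w))
    u·⊑ = ⊑-reflexive (begin
      (~ y · x) · (u ⇒ v)    ≈⟨ ·-cong (·-comm (~ y) x) (curry≈ (~ y) x v) ⟩
      (x · ~ y) · (~ y ⇒ w)  ≈⟨ ·-assoc _ _ _ ⟩
      x · (~ y · (~ y ⇒ w))  ∎)

    swap : ~ y · (~ y ⇒ w) ⊑ w · (w ⇒ ~ y)
    swap = ∧⊑divisible (⊑-trans (⊑-reflexive (divisible _ _)) ∧-lbʳ)
                       (⊑-trans (⊑-reflexive (divisible _ _)) ∧-lbˡ)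

    x·w⊑v : x · w ⊑ v
    x·w⊑v = ⊑-trans (⊑-reflexive (·-comm x w)) eval

    y·⊑x : y · (w ⇒ ~ y) ⊑ x
    y·⊑x = ⊑-trans (⊑-reflexive (≈-trans (·-comm _ _) (·-cong (contrapose w y) ≈-refl)))
             (⊑-trans eval (⊑-trans (~-anti x⊑x⊕y) (⊑-reflexive (~-involutive x))))

    u∧v⊑0 : u · (u ⇒ v) ⊑ 0#
    u∧v⊑0 = ⊑-trans u·⊑ (⊑-trans (·-mono ⊑-refl swap)
      (⊑-trans (⊑-reflexive (≈-sym (·-assoc _ _ _)))
      (⊑-trans (·-mono x·w⊑v ⊑-refl)
      (⊑-trans (⊑-reflexive (·-assoc _ _ _))
      (⊑-trans (·-mono ⊑-refl y·⊑x) ~x·x⊑0)))))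

    ~[]⊑0 : ~ ((x ⇒ y) ∨ (y ⇒ x)) ⊑ 0#
    ~[]⊑0 = ⊑-trans (∧⊑divisible (⊑-trans (~-anti ∨-ubˡ) ~⇒) (⊑-trans (~-anti ∨-ubʳ) ~⇒)) u∧v⊑0

record IsMVHomomorphism {a b ℓ₁ ℓ₂} (A : RawMVAlgebra a ℓ₁) (B : RawMVAlgebra b ℓ₂)
    (h : RawMVAlgebra.Carrier A → RawMVAlgebra.Carrier B) : Set (a ⊔ b ⊔ ℓ₁ ⊔ ℓ₂) where
  private
    module A = RawMVAlgebra A
    module B = RawMVAlgebra B
  field
    ≈-cong : ∀ {x y} → x A.≈ y → h x B.≈ h y
    ⊕-homo : ∀ x y → h (x A.⊕ y) B.≈ h x B.⊕ h y
    ~-homo : ∀ x → h (A.~ x) B.≈ B.~ h x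
    0-homo : h A.0# B.≈ B.0#

module _ {ℓ} (𝔸 : MVAlgebra ℓ) where
  open MVAlgebra 𝔸

  record IsCongruence (θ : Rel Carrier ℓ) : Set ℓ where
    field
      θ-isEquivalence : IsEquivalence θ
      θ-reflexive     : ∀ {x y} → x ≈ y → θ x y
      θ-⊕             : ∀ {x y z w} → θ x y → θ z w → θ (x ⊕ z) (y ⊕ w)
      θ-~             : ∀ {x y} → θ x y → θ (~ x) (~ y)

  -- Exactly two congruences: equality and the total relation.
  record IsSimple : Set (lsuc ℓ) where
    field
      nontrivial : ¬ (0# ≈ 1#)
      congruence : ∀ (θ : Rel Carrier ℓ) → IsCongruence θ →
                   (∀ {x y} → θ x y → x ≈ y) ⊎ (∀ x y → θ x y)

module _ {ℓ} (𝔸 : MVAlgebra ℓ) where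
  open MVAlgebra 𝔸

  -- The index set may be as large as the set of all filters.
  record IsSemisimple : Set (lsuc (lsuc ℓ)) where
    field
      Index        : Set (lsuc ℓ)
      factor       : Index → MVAlgebra ℓ
      simple       : ∀ i → IsSimple (factor i)
      proj         : ∀ i → Carrier → MVAlgebra.Carrier (factor i)
      homomorphism : ∀ i → IsMVHomomorphism raw (MVAlgebra.raw (factor i)) (proj i)
      surjective   : ∀ i y → ∃[ x ] MVAlgebra._≈_ (factor i) (proj i x) y
      injective    : ∀ {x y} → (∀ i → MVAlgebra._≈_ (factor i) (proj i x) (proj i y)) → x ≈ y

  record IsFilter (F : Pred Carrier ℓ) : Set ℓ where
    field
      1∈       : F 1#
      ·-closed : ∀ {x y} → F x → F y → F (x · y)
      ⊑-closed : ∀ {x y} → F x → x ⊑ y → F y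

  record MaximalFilter : Set (lsuc ℓ) where
    field
      Mem      : Pred Carrier ℓ
      isFilter : IsFilter Mem
      proper   : ¬ Mem 0#
      maximal  : ∀ (F : Pred Carrier ℓ) → IsFilter F → ¬ F 0# →
                 (∀ {x} → Mem x → F x) → ∀ {x} → F x → Mem x
    open IsFilter isFilter public

module FilterProperties {ℓ} (𝔸 : MVAlgebra ℓ) {F : Pred (MVAlgebra.Carrier 𝔸) ℓ}
                        (isFilter : IsFilter 𝔸 F) where
  open MVAlgebra 𝔸
  open MVProperties 𝔸
  open IsFilter isFilter

  infix 4 _∼_
  _∼_ : Rel Carrier ℓ
  x ∼ y = F (x ⇒ y) × F (y ⇒ x)

  ⊑⇒∈ : ∀ {x y} → x ⊑ y → F (x ⇒ y)
  ⊑⇒∈ p = ⊑-closed 1∈ (⊑-reflexive (≈-sym p))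

  mp : ∀ {x y} → F (x ⇒ y) → F x → F y
  mp p q = ⊑-closed (·-closed p q) eval

  ∈-≈ : ∀ {x y} → x ≈ y → F x → F y
  ∈-≈ e p = ⊑-closed p (⊑-reflexive e)

  ⇒-comp : ∀ {x y z} → F (x ⇒ y) → F (y ⇒ z) → F (x ⇒ z)
  ⇒-comp {x} {y} {z} p q = ⊑-closed (·-closed q p) (curry (⊑-trans (⊑-reflexive (·-assoc _ _ _))
    (⊑-trans (·-mono ⊑-refl eval) eval)))

  ⇒-~ : ∀ {x y} → F (x ⇒ y) → F (~ y ⇒ ~ x)
  ⇒-~ {x} {y} p = ∈-≈ (≈-trans (⊕-congˡ (≈-sym (~-involutive y))) (contrapose x (~ y))) p

  ⇒-⊕ʳ : ∀ {x y} z → F (x ⇒ y) → F (x ⊕ z ⇒ y ⊕ z)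
  ⇒-⊕ʳ {x} {y} z p = ⊑-closed p (curry (⊑-trans (⊑-reflexive (·-comm _ _)) (uncurry
    (⊑-trans (⊕-monoˡ z x⊑) (⊑-reflexive (⊕-assoc _ _ _))))))
    where
    x⊑ : x ⊑ (x ⇒ y) ⇒ y
    x⊑ = curry (⊑-trans (⊑-reflexive (·-comm _ _)) eval)

  ⇒-⊕ : ∀ {x y z w} → F (x ⇒ y) → F (z ⇒ w) → F (x ⊕ z ⇒ y ⊕ w)
  ⇒-⊕ {x} {y} {z} {w} p q = ⇒-comp (⇒-⊕ʳ z p)
    (⇒-comp (⊑⇒∈ (⊑-reflexive (⊕-comm y z)))
    (⇒-comp (⇒-⊕ʳ y q) (⊑⇒∈ (⊑-reflexive (⊕-comm w y)))))

  ∼-isCongruence : IsCongruence 𝔸 _∼_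
  ∼-isCongruence = record
    { θ-isEquivalence = record
      { refl  = ⊑⇒∈ ⊑-refl , ⊑⇒∈ ⊑-refl
      ; sym   = λ (p , q) → q , p
      ; trans = λ (p , q) (p′ , q′) → ⇒-comp p p′ , ⇒-comp q′ q
      }
    ; θ-reflexive = λ e → ⊑⇒∈ (⊑-reflexive e) , ⊑⇒∈ (⊑-reflexive (≈-sym e))
    ; θ-⊕ = λ (p , q) (p′ , q′) → ⇒-⊕ p p′ , ⇒-⊕ q q′
    ; θ-~ = λ (p , q) → ⇒-~ q , ⇒-~ p
    }

  -- Maximal filters are prime.
  module _ (maximal : ∀ (F′ : Pred Carrier ℓ) → IsFilter 𝔸 F′ → ¬ F′ 0# →
                      (∀ {x} → F x → F′ x) → ∀ {x} → F′ x → F x) where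

    prime : ∀ {x y} → F (x ∨ y) → ¬ F y → F x
    prime {x} {y} x∨y∈F y∉F = maximal F∨y
      (record
        { 1∈ = ⊑-closed 1∈ ∨-ubˡ
        ; ·-closed = λ {a} {b} p q → ⊑-closed (·-closed p q)
            (·-∨ (⊑-trans (⊑-reflexive (·-comm _ _))
                   (·-∨ (⊑-trans (⊑-reflexive (·-comm _ _)) ∨-ubˡ) (⊑-trans x·y⊑x ∨-ubʳ)))
                 (⊑-trans x·y⊑x ∨-ubʳ))
        ; ⊑-closed = λ p a⊑b → ⊑-closed p (∨-lub (⊑-trans a⊑b ∨-ubˡ) ∨-ubʳ)
        })
      (λ p → y∉F (⊑-closed p (∨-lub 0⊑ ⊑-refl)))
      (λ p → ⊑-closed p ∨-ubˡ)
      x∨y∈F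
      where
      F∨y : Pred Carrier ℓ
      F∨y z = F (z ∨ y)

    linear : ∀ x y → ¬ F (x ⇒ y) → F (y ⇒ x)
    linear x y p = prime (⊑-closed 1∈ (prelinear y x)) p

-- The quotient by a filter has the same carrier and the congruence as equality.
quotientMV : ∀ {ℓ} (𝔸 : MVAlgebra ℓ) {F : Pred (MVAlgebra.Carrier 𝔸) ℓ} → IsFilter 𝔸 F → MVAlgebra ℓ
quotientMV 𝔸 isFilter = record
  { raw = record { Carrier = Carrier ; _≈_ = _∼_ ; _⊕_ = _⊕_ ; ~_ = ~_ ; 0# = 0# }
  ; isCommutativeMonoid = record
    { isMonoid = record
      { isSemigroup = record
        { isMagma = record { isEquivalence = θ-isEquivalence ; ∙-cong = θ-⊕ }
        ; assoc = λ x y z → θ-reflexive (⊕-assoc x y z)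
        }
      ; identity = (λ x → θ-reflexive (⊕-identityˡ x)) , (λ x → θ-reflexive (⊕-identityʳ x))
      }
    ; comm = λ x y → θ-reflexive (⊕-comm x y)
    }
  ; ~-cong       = θ-~
  ; ~-involutive = λ x → θ-reflexive (~-involutive x)
  ; ⊕-zeroʳ      = λ x → θ-reflexive (⊕-zeroʳ x)
  ; łukasiewicz  = λ x y → θ-reflexive (łukasiewicz x y)
  }
  where
  open MVAlgebra 𝔸
  open FilterProperties 𝔸 isFilter
  open IsCongruence ∼-isCongruence

-- The real unit interval.  A real x is its set of rationals below x: a lower
-- set of rationals without a greatest element, containing every p < 0 and
-- contained in (-∞, 1).
record 𝕀 ℓ : Set (lsuc ℓ) where
  field
    below      : Pred ℚ ℓ
    below-down : ∀ {p q} → p < q → below q → below p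
    below-open : ∀ {p} → below p → ∃[ q ] (p < q × below q)
    below-neg  : ∀ {p} → p < 0ℚ → below p
    below-<1   : ∀ {p} → below p → p < 1ℚ

infix 4 _≺_ _≤ᴵ_ _≃_

_≺_ : ∀ {ℓ} → ℚ → 𝕀 ℓ → Set ℓ
p ≺ α = 𝕀.below α p

_≤ᴵ_ _≃_ : ∀ {ℓ} → Rel (𝕀 ℓ) ℓ
α ≤ᴵ β = ∀ {p} → p ≺ α → p ≺ β
α ≃ β = α ≤ᴵ β × β ≤ᴵ α

record 𝕀ℚ : Set where
  constructor mk𝕀ℚ
  field
    value : ℚ
    0≤v   : 0ℚ ≤ value
    v≤1   : value ≤ 1ℚ

open 𝕀ℚ public using (value)

0𝕀ℚ 1𝕀ℚ : 𝕀ℚ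
0𝕀ℚ = mk𝕀ℚ 0ℚ ℚ.≤-refl ℚ-Lemmas.0≤1
1𝕀ℚ = mk𝕀ℚ 1ℚ ℚ-Lemmas.0≤1 ℚ.≤-refl

module _ {ℓ : Level} where
  open ℚ-Lemmas
  open 𝕀
  open +-*-Solver

  fromℚ : 𝕀ℚ → 𝕀 ℓ
  fromℚ r = record
    { below      = λ p → Lift ℓ (p < value r)
    ; below-down = λ p<q (lift q<r) → lift (ℚ.<-trans p<q q<r)
    ; below-open = λ (lift p<r) → let (m , p<m , m<r) = ℚ.<-dense p<r in m , p<m , lift m<r
    ; below-neg  = λ p<0 → lift (ℚ.<-≤-trans p<0 (𝕀ℚ.0≤v r))
    ; below-<1   = λ (lift p<r) → ℚ.<-≤-trans p<r (𝕀ℚ.v≤1 r)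
    }

  -- p < 1 - x  iff  x ≤ 1 - q for some q > p.
  ~ᴵ_ : 𝕀 ℓ → 𝕀 ℓ
  ~ᴵ α = record
    { below      = λ p → ∃[ q ] (p < q × ¬ (1ℚ - q) ≺ α)
    ; below-down = λ p<p′ (q , p′<q , h) → q , ℚ.<-trans p<p′ p′<q , h
    ; below-open = λ (q , p<q , h) → let (m , p<m , m<q) = ℚ.<-dense p<q in m , p<m , q , m<q , h
    ; below-neg  = λ p<0 → 0ℚ , p<0 , λ h → ℚ.<-irrefl refl (below-<1 α h)
    ; below-<1   = λ { {p} (q , p<q , h) → ℚ.<-≤-trans p<q (ℚ.≮⇒≥ λ 1<q →
        h (below-neg α (0<⇒< (<⇒0< 1<q)
          (solve 2 (λ q o → q :- o := con 0ℚ :- (o :- q)) refl q 1ℚ)))) }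
    }

  -- min (x + y, 1)
  _⊕ᴵ_ : 𝕀 ℓ → 𝕀 ℓ → 𝕀 ℓ
  α ⊕ᴵ β = record
    { below      = λ p → p < 1ℚ × ∃[ a ] ∃[ b ] (a ≺ α × b ≺ β × p < a + b)
    ; below-down = λ p<q (q<1 , a , b , a≺ , b≺ , q<) →
        ℚ.<-trans p<q q<1 , a , b , a≺ , b≺ , ℚ.<-trans p<q q<
    ; below-open = open′
    ; below-neg  = neg′
    ; below-<1   = proj₁
    }
    where
    open′ : ∀ {p} → p < 1ℚ × ∃[ a ] ∃[ b ] (a ≺ α × b ≺ β × p < a + b) →
            ∃[ q ] (p < q × q < 1ℚ × ∃[ a ] ∃[ b ] (a ≺ α × b ≺ β × q < a + b))
    open′ (p<1 , a , b , a≺ , b≺ , p<) with ℚ.<-dense p<1 | ℚ.<-dense p<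
    ... | m , p<m , m<1 | n , p<n , n< with m ℚ.≤? n
    ...   | yes m≤n = m , p<m , m<1 , a , b , a≺ , b≺ , ℚ.≤-<-trans m≤n n<
    ...   | no  m≰n = n , p<n , ℚ.<-trans (ℚ.≰⇒> m≰n) m<1 , a , b , a≺ , b≺ , n<

    neg′ : ∀ {p} → p < 0ℚ → p < 1ℚ × ∃[ a ] ∃[ b ] (a ≺ α × b ≺ β × p < a + b)
    neg′ {p} p<0 with ℚ.<-dense p<0
    ... | m , p<m , m<0 with halve (<⇒0< m<0)
    ...   | h , 0<h , h+h≡ = ℚ.<-trans p<0 0<1 , 0ℚ - h , 0ℚ - h , below-neg α -h<0 , below-neg β -h<0 ,
      0<⇒< (<⇒0< p<m) (trans
        (cong (λ z → z - p) (trans (solve 1 (λ m → m := con 0ℚ :- (con 0ℚ :- m)) refl m) (cong (λ z → 0ℚ - z) (sym h+h≡))))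
        (solve 2 (λ h p → (con 0ℚ :- (h :+ h)) :- p := ((con 0ℚ :- h) :+ (con 0ℚ :- h)) :- p) refl h p))
      where
      -h<0 : 0ℚ - h < 0ℚ
      -h<0 = 0<⇒< 0<h (solve 1 (λ h → h := con 0ℚ :- (con 0ℚ :- h)) refl h)

  -- p < inf iff some q > p is a lower bound; the infimum of the empty family is 1.
  ⋀ : {I : Set ℓ} → (I → 𝕀 ℓ) → 𝕀 ℓ
  ⋀ α = record
    { below      = λ p → p < 1ℚ × ∃[ q ] (p < q × ∀ i {r} → r < q → r ≺ α i)
    ; below-down = λ p<p′ (p′<1 , q , p′<q , h) → ℚ.<-trans p<p′ p′<1 , q , ℚ.<-trans p<p′ p′<q , h
    ; below-open = open′
    ; below-neg  = λ p<0 → ℚ.<-trans p<0 0<1 , 0ℚ , p<0 , λ i → below-neg (α i)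
    ; below-<1   = proj₁
    }
    where
    open′ : ∀ {p} → p < 1ℚ × ∃[ q ] (p < q × ∀ i {r} → r < q → r ≺ α i) →
            ∃[ m ] (p < m × m < 1ℚ × ∃[ q ] (m < q × ∀ i {r} → r < q → r ≺ α i))
    open′ (p<1 , q , p<q , h) with ℚ.<-dense p<1 | ℚ.<-dense p<q
    ... | m , p<m , m<1 | n , p<n , n<q with m ℚ.≤? n
    ...   | yes m≤n = m , p<m , m<1 , q , ℚ.≤-<-trans m≤n n<q , h
    ...   | no  m≰n = n , p<n , ℚ.<-trans (ℚ.≰⇒> m≰n) m<1 , q , n<q , h

  ⋀-lower : {I : Set ℓ} (α : I → 𝕀 ℓ) (i : I) → ⋀ α ≤ᴵ α i
  ⋀-lower α i (_ , q , p<q , h) = h i p<q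

  ⋀-greatest : {I : Set ℓ} (α : I → 𝕀 ℓ) {β : 𝕀 ℓ} → (∀ i → β ≤ᴵ α i) → β ≤ᴵ ⋀ α
  ⋀-greatest α {β} h b with below-open β b
  ... | q , p<q , q≺β = below-<1 β b , q , p<q , λ i r<q → h i (below-down β r<q q≺β)

  ⊕ᴵ-mono : {α α′ β β′ : 𝕀 ℓ} → α ≤ᴵ α′ → β ≤ᴵ β′ → α ⊕ᴵ β ≤ᴵ α′ ⊕ᴵ β′
  ⊕ᴵ-mono α≤ β≤ (p<1 , a , b , a≺ , b≺ , p<) = p<1 , a , b , α≤ a≺ , β≤ b≺ , p<

standardMV : ∀ ℓ → RawMVAlgebra (lsuc ℓ) ℓ
standardMV ℓ = record
  { Carrier = 𝕀 ℓ ; _≈_ = _≃_ ; _⊕_ = _⊕ᴵ_ ; ~_ = ~ᴵ_ ; 0# = fromℚ 0𝕀ℚ }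

module _ {ℓ : Level} where
  open RawMVAlgebra (standardMV ℓ) public using () renaming (_⇒_ to _⇒ᴵ_; _·_ to _·ᴵ_)

1ᴵ : ∀ {ℓ} → 𝕀 ℓ
1ᴵ = fromℚ 1𝕀ℚ

module 𝕀-Lemmas (em : EM) {ℓ : Level} where
  open ℚ-Lemmas
  open 𝕀
  open +-*-Solver

  ≤⇒⇒ : ∀ {α β : 𝕀 ℓ} → α ≤ᴵ β → ∀ {p} → p < 1ℚ → p ≺ α ⇒ᴵ β
  ≤⇒⇒ {α} {β} α≤β {p} p<1 = by-contradiction em contra
    where
    module _ (p⊀ : ¬ p ≺ α ⇒ᴵ β) {e : ℚ} (0<e : 0ℚ < e) (p≡ : 1ℚ - p ≡ (e + e) + (e + e)) where
      sum≡ : ∀ x → e + e ≡ (((1ℚ - (x + e)) - e) + x) - p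
      sum≡ x = trans
        (solve 1 (λ e → e :+ e := (((e :+ e) :+ (e :+ e)) :- e) :- e) refl e)
        (trans (cong (λ z → z - e - e) (sym p≡))
          (solve 4 (λ x e p o → ((o :- p) :- e) :- e := (((o :- (x :+ e)) :- e) :+ x) :- p) refl x e p 1ℚ))

      step : ∀ {x} → x ≺ α → (x + e) ≺ α
      step {x} x≺ = by-contradiction em λ x+e⊀ → p⊀
        ( p<1 , 1ℚ - (x + e) - e , x
        , (1ℚ - (x + e) , 0<⇒< 0<e (solve 2 (λ y e → e := y :- (y :- e)) refl (1ℚ - (x + e)) e)
          , λ h → x+e⊀ (subst (_≺ α) (solve 2 (λ y o → o :- (o :- y) := y) refl (x + e) 1ℚ) h))
        , α≤β x≺
        , 0<⇒< (0<+0< 0<e 0<e) (sum≡ x) )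

      absurd : ⊥
      absurd =
        let (x , x≺ , 1<x) = unbounded (_≺ α) 0<e (below-neg α -1<0) step 1ℚ
        in <-contra 1<x (ℚ.<⇒≤ (below-<1 α x≺))

    contra : ¬ p ≺ α ⇒ᴵ β → ⊥
    contra p⊀ = let (e , 0<e , p≡) = quarter (<⇒0< p<1) in absurd p⊀ 0<e p≡

  ⇒⇒≤ : ∀ {α β : 𝕀 ℓ} → (∀ {p} → p < 1ℚ → p ≺ α ⇒ᴵ β) → α ≤ᴵ β
  ⇒⇒≤ {α} {β} h {p} p≺ =
    let (q , p<q , q≺) = below-open α p≺
        (_ , a , b , (s , a<s , 1-s⊀) , b≺ , r<) =
          h {1ℚ - (q - p)} (0<⇒< (<⇒0< p<q) (solve 2 (λ d o → d := o :- (o :- d)) refl (q - p) 1ℚ))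
        q≤1-s = ℚ.≮⇒≥ λ 1-s<q → 1-s⊀ (below-down α 1-s<q q≺)
    in below-down β (bound a b q s r< q≤1-s a<s) b≺
    where
    bound : ∀ a b q s → 1ℚ - (q - p) < a + b → q ≤ 1ℚ - s → a < s → p < b
    bound a b q s r< q≤ a<s = 0<⇒< (0<+0< (0<+0≤ (<⇒0< r<) (≤⇒0≤ q≤)) (<⇒0< a<s))
      (solve 6 (λ a b q p s o → (((a :+ b) :- (o :- (q :- p))) :+ ((o :- s) :- q)) :+ (s :- a) := b :- p) refl a b q p s 1ℚ)

record PavelkaAlgebra ℓ : Set (lsuc ℓ) where
  field
    mvAlgebra : MVAlgebra ℓ
  open MVAlgebra mvAlgebra public
  field
    const   : 𝕀ℚ → Carrier
    const-0 : const 0𝕀ℚ ≈ 0#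
    const-⊕ : ∀ r s t → (value r + value s) ⊓ 1ℚ ≡ value t → const r ⊕ const s ≈ const t
    const-~ : ∀ r s → 1ℚ - value r ≡ value s → ~ const r ≈ const s

quotient : ∀ {ℓ} (𝐀 : PavelkaAlgebra ℓ) → MaximalFilter (PavelkaAlgebra.mvAlgebra 𝐀) → PavelkaAlgebra ℓ
quotient 𝐀 F = record
  { mvAlgebra = quotientMV mvAlgebra isFilter
  ; const     = const
  ; const-0   = θ-reflexive const-0
  ; const-⊕   = λ r s t e → θ-reflexive (const-⊕ r s t e)
  ; const-~   = λ r s e → θ-reflexive (const-~ r s e)
  }
  where
  open PavelkaAlgebra 𝐀
  open MaximalFilter F using (isFilter)
  open IsCongruence (FilterProperties.∼-isCongruence mvAlgebra isFilter)

record Embedding {ℓ} (𝐁 : PavelkaAlgebra ℓ) : Set (lsuc ℓ) where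
  open PavelkaAlgebra 𝐁
  field
    map            : Carrier → 𝕀 ℓ
    isHomomorphism : IsMVHomomorphism raw (standardMV ℓ) map
    const-homo     : ∀ r → map (const r) ≃ fromℚ r
    injective      : ∀ {x y} → map x ≃ map y → x ≈ y
  open IsMVHomomorphism isHomomorphism public

module QuotientEmbedding (em : EM) {ℓ} (𝐀 : PavelkaAlgebra ℓ)
                         (F : MaximalFilter (PavelkaAlgebra.mvAlgebra 𝐀)) where
  open PavelkaAlgebra 𝐀
  open MVProperties mvAlgebra
  open MaximalFilter F
  open FilterProperties mvAlgebra isFilter hiding (linear)
  open ℚ-Lemmas
  open +-*-Solver
  open 𝕀 hiding (below)
  open 𝕀-Lemmas em {ℓ}

  linear : ∀ x y → ¬ Mem (x ⇒ y) → Mem (y ⇒ x)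
  linear = FilterProperties.linear mvAlgebra isFilter maximal

  const-cong : ∀ {r s} → value r ≡ value s → const r ≈ const s
  const-cong {r} {s} e = ≈-trans (≈-sym (⊕-identityʳ _)) (≈-trans (⊕-congˡ (≈-sym const-0))
    (const-⊕ r 0𝕀ℚ s (trans (cong (_⊓ 1ℚ) (trans (ℚ.+-identityʳ (value r)) e)) (ℚ.p≤q⇒p⊓q≡p (𝕀ℚ.v≤1 s)))))

  const-1 : const 1𝕀ℚ ≈ 1#
  const-1 = ≈-sym (≈-trans (~-cong (≈-sym const-0)) (const-~ 0𝕀ℚ 1𝕀ℚ refl))

  compl : 𝕀ℚ → 𝕀ℚ
  compl r = mk𝕀ℚ (1ℚ - value r) (≤⇒0≤ (𝕀ℚ.v≤1 r))
    (0≤⇒≤ (𝕀ℚ.0≤v r) (solve 2 (λ r o → r := o :- (o :- r)) refl (value r) 1ℚ))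

  const-compl : ∀ r → ~ const r ≈ const (compl r)
  const-compl r = const-~ r (compl r) refl

  const-⇒ : ∀ r s t → (1ℚ - value r + value s) ⊓ 1ℚ ≡ value t → const r ⇒ const s ≈ const t
  const-⇒ r s t e = ≈-trans (⊕-congʳ (const-compl r)) (const-⊕ (compl r) s t e)

  const-mono : ∀ {r s} → value r ≤ value s → const r ⊑ const s
  const-mono {r} {s} r≤s = ≈-trans (const-⇒ r s 1𝕀ℚ (ℚ.p≥q⇒p⊓q≡q {p = 1ℚ - value r + value s}
    (0≤⇒≤ (≤⇒0≤ r≤s) (solve 3 (λ r s o → s :- r := ((o :- r) :+ s) :- o) refl (value r) (value s) 1ℚ)))) const-1

  const-· : ∀ r s t → value t ≡ value r + value s - 1ℚ → const r · const s ≈ const t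
  const-· r s t e = ≈-trans (~-cong (⊕-cong (const-compl r) (const-compl s)))
    (≈-trans (~-cong (const-⊕ (compl r) (compl s) (compl t) (trans (ℚ.p≤q⇒p⊓q≡p ≤1) e′)))
    (const-~ (compl t) t (solve 2 (λ t o → o :- (o :- t) := t) refl (value t) 1ℚ)))
    where
    e′ : (1ℚ - value r) + (1ℚ - value s) ≡ 1ℚ - value t
    e′ = trans (solve 3 (λ r s o → (o :- r) :+ (o :- s) := o :- ((r :+ s) :- o)) refl (value r) (value s) 1ℚ)
               (cong (λ z → 1ℚ - z) (sym e))
    ≤1 : (1ℚ - value r) + (1ℚ - value s) ≤ 1ℚ
    ≤1 = subst (_≤ 1ℚ) (sym e′) (𝕀ℚ.v≤1 (compl t))

  const-·0 : ∀ r s → value r + value s - 1ℚ ≤ 0ℚ → const r · const s ≈ 0#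
  const-·0 r s le = ≈-trans (~-cong (⊕-cong (const-compl r) (const-compl s)))
    (≈-trans (~-cong (≈-trans (const-⊕ (compl r) (compl s) 1𝕀ℚ (ℚ.p≥q⇒p⊓q≡q {p = (1ℚ - value r) + (1ℚ - value s)}
      (0≤⇒≤ (≤⇒0≤ le) (solve 3 (λ r s o → con 0ℚ :- ((r :+ s) :- o) := ((o :- r) :+ (o :- s)) :- o) refl (value r) (value s) 1ℚ))))
      const-1)) ~1≈0)

  const-proper : ∀ r → Mem (const r) → 1ℚ ≤ value r
  const-proper r r∈ = ℚ.≮⇒≥ λ r<1 → contra r<1
    where
    P : Pred ℚ ℓ
    P x = ∃[ s ] (Mem (const s) × value s ≤ 1ℚ - x)

    step : ∀ {x} → P x → P (x + (1ℚ - value r))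
    step {x} (s , s∈ , s≤) = cases (value s + value r - 1ℚ ℚ.≤? 0ℚ)
      where
      cases : Dec (value s + value r - 1ℚ ≤ 0ℚ) → P (x + (1ℚ - value r))
      cases (yes le) = ⊥-elim (proper (∈-≈ (const-·0 s r le) (·-closed s∈ r∈)))
      cases (no nle) = t , ∈-≈ (const-· s r t refl) (·-closed s∈ r∈) ,
          0≤⇒≤ (≤⇒0≤ s≤) (solve 4 (λ s r x o → (o :- x) :- s := (o :- (x :+ (o :- r))) :- ((s :+ r) :- o)) refl (value s) (value r) x 1ℚ)
        where
        t : 𝕀ℚ
        t = mk𝕀ℚ (value s + value r - 1ℚ) (ℚ.<⇒≤ (ℚ.≰⇒> nle))
          (0≤⇒≤ (0≤+0≤ (≤⇒0≤ (𝕀ℚ.v≤1 s)) (≤⇒0≤ (𝕀ℚ.v≤1 r)))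
            (solve 3 (λ s r o → (o :- s) :+ (o :- r) := o :- ((s :+ r) :- o)) refl (value s) (value r) 1ℚ))

    contra : value r < 1ℚ → ⊥
    contra r<1 =
      let (x , (s , _ , s≤) , 1<x) =
            unbounded P {a = 0ℚ} (<⇒0< r<1) (1𝕀ℚ , ∈-≈ (≈-sym const-1) 1∈ , ℚ.≤-refl)
              (λ {x} → step {x}) 1ℚ
      in <-contra (0<⇒< (0<+0≤ (<⇒0< 1<x) (≤⇒0≤ s≤))
          (solve 3 (λ x s o → (x :- o) :+ ((o :- x) :- s) := con 0ℚ :- s) refl x (value s) 1ℚ)) (𝕀ℚ.0≤v s)

  ⇒-· : ∀ {x y z w} → Mem (x ⇒ y) → Mem (z ⇒ w) → Mem (x · z ⇒ y · w)
  ⇒-· p q = ⇒-~ (⇒-⊕ (⇒-~ p) (⇒-~ q))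

  -- x ∈ F as soon as x/F ≥ q for all q < 1.
  ∈-limit : ∀ {x} → (∀ q → value q < 1ℚ → Mem (const q ⇒ x)) → Mem x
  ∈-limit = maximal F′
    (record
      { 1∈ = λ _ _ → ⊑⇒∈ ⊑1
      ; ·-closed = closed
      ; ⊑-closed = λ h x⊑y q q<1 → ⊑-closed (h q q<1) (⇒-mono ⊑-refl x⊑y)
      })
    (λ h → <-contra ½<1 (const-proper ½𝕀ℚ (∈-≈ (≈-trans (⊕-identityʳ _) (const-~ ½𝕀ℚ ½𝕀ℚ refl)) (h ½𝕀ℚ ½<1))))
    (λ x∈ _ _ → ⊑-closed x∈ (curry x·y⊑x))
    where
    F′ : Pred Carrier ℓ
    F′ x = ∀ q → value q < 1ℚ → Mem (const q ⇒ x)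

    ½<1 : ½ < 1ℚ
    ½<1 = 0<⇒< {d = ½} (ℚ.positive⁻¹ ½) refl

    ½𝕀ℚ : 𝕀ℚ
    ½𝕀ℚ = mk𝕀ℚ ½ (ℚ.<⇒≤ (ℚ.positive⁻¹ ½)) (ℚ.<⇒≤ ½<1)

    closed : ∀ {x y} → F′ x → F′ y → F′ (x · y)
    closed {x} {y} hx hy p p<1 = let (h , 0<h , h+h≡) = halve (<⇒0< p<1) in go h 0<h h+h≡
      where
      go : ∀ h → 0ℚ < h → h + h ≡ 1ℚ - value p → Mem (const p ⇒ x · y)
      go h 0<h h+h≡ = ∈-≈ (⊕-congʳ (~-cong (const-· q q p p≡))) (⇒-· (hx q q<1) (hy q q<1))
        where
        v : ℚ
        v = value p
        q<1 : 1ℚ - h < 1ℚ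
        q<1 = 0<⇒< 0<h (solve 2 (λ h o → h := o :- (o :- h)) refl h 1ℚ)
        p≡ : v ≡ (1ℚ - h) + (1ℚ - h) - 1ℚ
        p≡ = trans (solve 2 (λ p o → p := o :- (o :- p)) refl v 1ℚ) (trans (cong (λ z → 1ℚ - z) (sym h+h≡))
               (solve 2 (λ h o → o :- (h :+ h) := ((o :- h) :+ (o :- h)) :- o) refl h 1ℚ))
        q : 𝕀ℚ
        q = mk𝕀ℚ (1ℚ - h) (0≤⇒≤ (0≤+0≤ (𝕀ℚ.0≤v p) (ℚ.<⇒≤ 0<h))
              (trans (cong (_+ h) p≡) (solve 2 (λ h o → (((o :- h) :+ (o :- h)) :- o) :+ h := (o :- h) :- con 0ℚ) refl h 1ℚ)))
              (ℚ.<⇒≤ q<1)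

  -- val x is the supremum of the q with q → x ∈ F; `embedding` and `unique` below
  -- show that it is the unique embedding of 𝐀/F into [0,1].
  val : Carrier → 𝕀 ℓ
  val x = record
    { below      = λ p → ∃[ q ] (p < value q × Mem (const q ⇒ x))
    ; below-down = λ p<p′ (q , p′<q , m) → q , ℚ.<-trans p<p′ p′<q , m
    ; below-open = λ (q , p<q , m) → let (n , p<n , n<q) = ℚ.<-dense p<q in n , p<n , q , n<q , m
    ; below-neg  = λ p<0 → 0𝕀ℚ , p<0 , ⊑⇒∈ (⊑-trans (⊑-reflexive const-0) 0⊑)
    ; below-<1   = λ (q , p<q , _) → ℚ.<-≤-trans p<q (𝕀ℚ.v≤1 q)
    }

  val-mono : ∀ {x y} → Mem (x ⇒ y) → val x ≤ᴵ val y
  val-mono m (q , p<q , m′) = q , p<q , ⇒-comp m′ m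

  val-const : ∀ r → val (const r) ≃ fromℚ r
  val-const r = (λ { {p} (q , p<q , m) → lift (ℚ.≰⇒> λ r≤p → contra p<q m r≤p) }) ,
                (λ (lift p<r) → r , p<r , ⊑⇒∈ ⊑-refl)
    where
    contra : ∀ {p q} → p < value q → Mem (const q ⇒ const r) → value r ≤ p → ⊥
    contra {p} {q} p<q m r≤p = <-contra
      (0<⇒< (0<+0≤ (<⇒0< p<q) (≤⇒0≤ r≤p)) (solve 4 (λ p q r o → (q :- p) :+ (p :- r) := o :- ((o :- q) :+ r)) refl p (value q) (value r) 1ℚ))
      (const-proper t (∈-≈ (const-⇒ q r t (ℚ.p≤q⇒p⊓q≡p (𝕀ℚ.v≤1 t))) m))
      where
      t : 𝕀ℚ
      t = mk𝕀ℚ (1ℚ - value q + value r) (0≤+0≤ (𝕀ℚ.0≤v (compl q)) (𝕀ℚ.0≤v r))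
        (0≤⇒≤ (0≤+0≤ (≤⇒0≤ (ℚ.<⇒≤ p<q)) (≤⇒0≤ r≤p))
          (solve 4 (λ p q r o → (q :- p) :+ (p :- r) := o :- ((o :- q) :+ r)) refl p (value q) (value r) 1ℚ))

  ⊀⇒ : ∀ {x v} → ¬ v ≺ val x → ∀ q → v < value q → Mem (x ⇒ const q)
  ⊀⇒ {x} v⊀ q v<q = linear (const q) x λ m → v⊀ (q , v<q , m)

  val-~ : ∀ x → val (~ x) ≃ ~ᴵ val x
  val-~ x = to , from
    where
    to : val (~ x) ≤ᴵ ~ᴵ val x
    to (q , p<q , m) = value q , p<q , λ (s , 1-q<s , m′) → contra q s 1-q<s m m′
      where
      contra : ∀ q s → 1ℚ - value q < value s → Mem (const q ⇒ ~ x) → Mem (const s ⇒ x) → ⊥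
      contra q s 1-q<s m m′ = <-contra (0<⇒< (<⇒0< 1-q<s) t≡)
        (const-proper t (∈-≈ t≈ (⇒-comp m′ (∈-≈ (contrapose (const q) x) m))))
        where
        t≡ : value s - (1ℚ - value q) ≡ 1ℚ - (1ℚ - value s + (1ℚ - value q))
        t≡ = solve 3 (λ q s o → s :- (o :- q) := o :- ((o :- s) :+ (o :- q))) refl (value q) (value s) 1ℚ
        t : 𝕀ℚ
        t = mk𝕀ℚ (1ℚ - value s + (1ℚ - value q)) (0≤+0≤ (𝕀ℚ.0≤v (compl s)) (𝕀ℚ.0≤v (compl q)))
              (0≤⇒≤ (ℚ.<⇒≤ (<⇒0< 1-q<s)) t≡)
        t≈ : const s ⇒ ~ const q ≈ const t
        t≈ = ≈-trans (⊕-congˡ (const-compl q)) (const-⇒ s (compl q) t (ℚ.p≤q⇒p⊓q≡p (𝕀ℚ.v≤1 t)))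

    from : ~ᴵ val x ≤ᴵ val (~ x)
    from {p} (q , p<q , 1-q⊀) =
      let (m , p<m , m<q) = ℚ.<-dense p<q in cases q 1-q⊀ m p<m m<q (0ℚ ℚ.≤? m)
      where
      cases : ∀ q → ¬ (1ℚ - q) ≺ val x → ∀ m → p < m → m < q → Dec (0ℚ ≤ m) → p ≺ val (~ x)
      cases q 1-q⊀ m p<m m<q (no  0≰m) = 0𝕀ℚ , ℚ.<-trans p<m (ℚ.≰⇒> 0≰m) , ⊑⇒∈ (⊑-trans (⊑-reflexive const-0) 0⊑)
      cases q 1-q⊀ m p<m m<q (yes 0≤m) = m′ , p<m ,
        ∈-≈ (≈-trans (⊕-congˡ (≈-sym (const-compl m′))) (contrapose x (const m′)))
          (⊀⇒ 1-q⊀ (compl m′) (0<⇒< (<⇒0< m<q) (solve 3 (λ m q o → q :- m := (o :- m) :- (o :- q)) refl m q 1ℚ)))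
        where
        q≤1 : q ≤ 1ℚ
        q≤1 = ℚ.≮⇒≥ λ 1<q → 1-q⊀ (below-neg (val x)
          (0<⇒< (<⇒0< 1<q) (solve 2 (λ q o → q :- o := con 0ℚ :- (o :- q)) refl q 1ℚ)))
        m′ : 𝕀ℚ
        m′ = mk𝕀ℚ m 0≤m (ℚ.<⇒≤ (ℚ.<-≤-trans m<q q≤1))

  val-⊕ : ∀ x y → val (x ⊕ y) ≃ val x ⊕ᴵ val y
  val-⊕ x y = to , from
    where
    from : val x ⊕ᴵ val y ≤ᴵ val (x ⊕ y)
    from {p} (p<1 , a , b , (q , a<q , m) , (s , b<s , m′) , p<a+b) =
      t , p<t , ∈-≈ (⊕-congʳ (~-cong (const-⊕ q s t refl))) (⇒-⊕ m m′)
      where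
      t : 𝕀ℚ
      t = mk𝕀ℚ ((value q + value s) ⊓ 1ℚ) (ℚ.⊓-glb (0≤+0≤ (𝕀ℚ.0≤v q) (𝕀ℚ.0≤v s)) 0≤1) (ℚ.p⊓q≤q (value q + value s) 1ℚ)
      p<t : p < (value q + value s) ⊓ 1ℚ
      p<t = cases (value q + value s ℚ.≤? 1ℚ)
        where
        cases : Dec (value q + value s ≤ 1ℚ) → p < (value q + value s) ⊓ 1ℚ
        cases (yes le) = subst (p <_) (sym (ℚ.p≤q⇒p⊓q≡p le)) (ℚ.<-trans p<a+b (ℚ.+-mono-< a<q b<s))
        cases (no nle) = subst (p <_) (sym (ℚ.p≥q⇒p⊓q≡q (ℚ.<⇒≤ (ℚ.≰⇒> nle)))) p<1

    to : val (x ⊕ y) ≤ᴵ val x ⊕ᴵ val y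
    to {p} (q , p<q , m) = by-contradiction em contra
      where
      module _ (p⊀ : ¬ p ≺ val x ⊕ᴵ val y) {e : ℚ} (0<e : 0ℚ < e)
               (q≡ : value q - p ≡ (e + e) + (e + e)) where
        step : ∀ {a} → a ≺ val x → (a + e) ≺ val x
        step {a} a≺ = cases (0ℚ ℚ.≤? b′) (b′ ℚ.≤? 1ℚ)
          where
          b b′ : ℚ
          b  = p - a + e
          b′ = b + e

          b⊀ : ¬ b ≺ val y
          b⊀ b≺ = p⊀ (ℚ.<-≤-trans p<q (𝕀ℚ.v≤1 q) , a , b , a≺ , b≺ ,
            0<⇒< 0<e (solve 3 (λ p a e → e := (a :+ ((p :- a) :+ e)) :- p) refl p a e))

          b<b′ : b < b′
          b<b′ = 0<⇒< 0<e (solve 2 (λ b e → e := (b :+ e) :- b) refl b e)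

          q-b′ : value q - b′ ≡ (a + e) + e
          q-b′ = trans (solve 4 (λ q p a e → q :- (((p :- a) :+ e) :+ e) := ((q :- p) :+ a) :- (e :+ e)) refl (value q) p a e)
            (trans (cong (λ z → z + a - (e + e)) q≡)
              (solve 2 (λ a e → (((e :+ e) :+ (e :+ e)) :+ a) :- (e :+ e) := (a :+ e) :+ e) refl a e))

          a+e< : a + e < value q - b′
          a+e< = 0<⇒< 0<e (trans (solve 2 (λ a e → e := (a :+ e) :- a) refl (a + e) e) (cong (λ z → z - (a + e)) (sym q-b′)))

          cases : Dec (0ℚ ≤ b′) → Dec (b′ ≤ 1ℚ) → (a + e) ≺ val x
          cases (no 0≰b′) _ = ⊥-elim (b⊀ (below-neg (val y) (ℚ.<-trans b<b′ (ℚ.≰⇒> 0≰b′))))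
          cases (yes _) (no b′≰1) = below-neg (val x) (ℚ.<-trans a+e<
            (0<⇒< (0<+0≤ (<⇒0< (ℚ.≰⇒> b′≰1)) (≤⇒0≤ (𝕀ℚ.v≤1 q)))
              (solve 3 (λ q b o → (b :- o) :+ (o :- q) := con 0ℚ :- (q :- b)) refl (value q) b′ 1ℚ)))
          cases (yes 0≤b′) (yes b′≤1) = cases′ (0ℚ ℚ.≤? value q - b′)
            where
            cases′ : Dec (0ℚ ≤ value q - b′) → (a + e) ≺ val x
            cases′ (no nle) = below-neg (val x) (ℚ.<-trans a+e< (ℚ.≰⇒> nle))
            cases′ (yes le) = d , a+e< , ∈-≈ (⊕-congʳ (~-cong (const-· q (compl c) d d≡)))
                  (∈-≈ (≈-sym (curry≈ _ _ _)) (∈-≈ (⊕-congˡ x⊕c≈) q⇒x⊕c))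
              where
              c d : 𝕀ℚ
              c = mk𝕀ℚ b′ 0≤b′ b′≤1
              d = mk𝕀ℚ (value q - b′) le (0≤⇒≤ (0≤+0≤ (≤⇒0≤ (𝕀ℚ.v≤1 q)) 0≤b′)
                    (solve 3 (λ q b o → (o :- q) :+ b := o :- (q :- b)) refl (value q) b′ 1ℚ))
              d≡ : value q - b′ ≡ value q + (1ℚ - b′) - 1ℚ
              d≡ = solve 3 (λ q b o → q :- b := (q :+ (o :- b)) :- o) refl (value q) b′ 1ℚ
              q⇒x⊕c : Mem (const q ⇒ x ⊕ const c)
              q⇒x⊕c = ⇒-comp m (⇒-⊕ (⊑⇒∈ ⊑-refl) (⊀⇒ b⊀ c b<b′))
              x⊕c≈ : x ⊕ const c ≈ const (compl c) ⇒ x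
              x⊕c≈ = ≈-trans (⊕-comm x _) (⊕-congʳ (≈-trans (≈-sym (~-involutive _)) (~-cong (const-compl c))))

        absurd : ⊥
        absurd =
          let (a , a≺ , 1<a) = unbounded (_≺ val x) 0<e (below-neg (val x) -1<0) step 1ℚ
          in <-contra 1<a (ℚ.<⇒≤ (below-<1 (val x) a≺))

      contra : ¬ p ≺ val x ⊕ᴵ val y → ⊥
      contra p⊀ = let (e , 0<e , q≡) = quarter (<⇒0< p<q) in absurd p⊀ 0<e q≡

  val-⇒ : ∀ x y → val x ⇒ᴵ val y ≤ᴵ val (x ⇒ y)
  val-⇒ x y {p} p≺ = proj₂ (val-⊕ (~ x) y)
    (⊕ᴵ-mono {α = ~ᴵ val x} {val (~ x)} {val y} {val y} (proj₂ (val-~ x)) (λ b → b) p≺)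

  val-reflects : ∀ {x y} → val x ≤ᴵ val y → Mem (x ⇒ y)
  val-reflects {x} {y} x≤y = ∈-limit λ q q<1 →
    let (s , q<s , m) = val-⇒ x y (≤⇒⇒ {α = val x} {val y} x≤y q<1)
    in ⇒-comp (⊑⇒∈ (const-mono (ℚ.<⇒≤ q<s))) m

  embedding : Embedding (quotient 𝐀 F)
  embedding = record
    { map = val
    ; isHomomorphism = record
      { ≈-cong = λ (m , m′) → val-mono m , val-mono m′
      ; ⊕-homo = val-⊕
      ; ~-homo = val-~
      ; 0-homo = (λ {p} h → proj₁ (val-const 0𝕀ℚ) (val-mono (⊑⇒∈ (⊑-reflexive (≈-sym const-0))) h)) ,
                 (λ {p} h → val-mono (⊑⇒∈ (⊑-reflexive const-0)) (proj₂ (val-const 0𝕀ℚ) h))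
      }
    ; const-homo = val-const
    ; injective = λ (x≤y , y≤x) → val-reflects x≤y , val-reflects y≤x
    }

  module _ (e : Embedding (quotient 𝐀 F)) where
    open Embedding e using (map; const-homo; ≈-cong; ⊕-homo; ~-homo; 0-homo)

    map-mono : ∀ {x y} → Mem (x ⇒ y) → map x ≤ᴵ map y
    map-mono {x} {y} m = ⇒⇒≤ {α = map x} {map y} λ p<1 →
      ⊕ᴵ-mono {α = map (~ x)} {~ᴵ map x} {map y} {map y} (proj₁ (~-homo x)) (λ b → b)
        (proj₁ (⊕-homo (~ x) y)
          (proj₁ (≈-cong {const 1𝕀ℚ} {x ⇒ y} (∈-≈ (≈-sym (≈-trans (⊕-congʳ (~-cong const-1)) (≈-trans (⊕-congʳ ~1≈0) (⊕-identityˡ _)))) m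
                                            , ⊑⇒∈ (⊑-trans ⊑1 (⊑-reflexive (≈-sym const-1)))))
            (proj₂ (const-homo 1𝕀ℚ) (lift p<1))))

    unique : ∀ x → map x ≃ val x
    unique x = to , from
      where
      from : val x ≤ᴵ map x
      from (q , p<q , m) = map-mono m (proj₂ (const-homo q) (lift p<q))

      to : map x ≤ᴵ val x
      to {p} p≺ = by-contradiction em λ p⊀ →
        let (m , p<m , m≺) = below-open (map x) p≺ in contra p⊀ m p<m m≺ (0ℚ ℚ.≤? m)
        where
        contra : ¬ p ≺ val x → ∀ m → p < m → m ≺ map x → Dec (0ℚ ≤ m) → ⊥
        contra p⊀ m p<m m≺ (no 0≰m) = p⊀ (below-neg (val x) (ℚ.<-trans p<m (ℚ.≰⇒> 0≰m)))
        contra p⊀ m p<m m≺ (yes 0≤m) =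
          ℚ.<-irrefl refl (Lift.lower (proj₁ (const-homo m′) (map-mono (⊀⇒ p⊀ m′ p<m) m≺)))
          where
          m′ : 𝕀ℚ
          m′ = mk𝕀ℚ m 0≤m (ℚ.<⇒≤ (below-<1 (map x) m≺))

record TensePavelkaAlgebra ℓ : Set (lsuc ℓ) where
  field
    pavelka : PavelkaAlgebra ℓ
  open PavelkaAlgebra pavelka public
  field
    G H    : Carrier → Carrier
    G-cong : ∀ {x y} → x ≈ y → G x ≈ G y
    H-cong : ∀ {x y} → x ≈ y → H x ≈ H y
    G-∧    : ∀ x y → G (x ∧ y) ≈ G x ∧ G y
    H-∧    : ∀ x y → H (x ∧ y) ≈ H x ∧ H y
    G-⇒    : ∀ r x → const r ⇒ G x ≈ G (const r ⇒ x)
    H-⇒    : ∀ r x → const r ⇒ H x ≈ H (const r ⇒ x)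
    ~H~G⊑  : ∀ x → ~ H (~ G x) ⊑ x
    ~G~H⊑  : ∀ x → ~ G (~ H x) ⊑ x

module _ {t ℓ} {T : Set t} (R : T → T → 𝕀 ℓ) where

  FuzzyReflexive : Set (t ⊔ ℓ)
  FuzzyReflexive = ∀ s → R s s ≃ 1ᴵ

  FuzzySymmetric : Set (t ⊔ ℓ)
  FuzzySymmetric = ∀ s t → R s t ≃ R t s

  FuzzyTransitive : Set (t ⊔ ℓ)
  FuzzyTransitive = ∀ s t u → R s t ·ᴵ R t u ≤ᴵ R s u

module NaturalFrame (em : EM) {ℓ} (𝐀 : TensePavelkaAlgebra ℓ) where
  open TensePavelkaAlgebra 𝐀

  SpecM : Set (lsuc ℓ)
  SpecM = MaximalFilter mvAlgebra

  infixl 7 _/_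

  -- The image of the class of x under the unique embedding of 𝐀/F into [0,1].
  _/_ : Carrier → SpecM → 𝕀 ℓ
  x / F = Embedding.map (QuotientEmbedding.embedding em pavelka F) x

  R : SpecM → SpecM → 𝕀 ℓ
  R F F′ = ⋀ λ a → (G a / F′) ⇒ᴵ (a / F)

{-# OPTIONS --safe #-}
-- Put ⟦x⟧(F) = x/F.  The heart of the matter is the representation
-- ⟦G a⟧(F′) = ⋀_F (R(F,F′) → ⟦a⟧(F)), after which everything is residuation in [0,1]
-- together with the separation of points of a semisimple algebra by Spec_M.  For ≥,
-- suppose q is not below ⟦G a⟧(F′) and set c = q → a, so G(c) ∉ F′ by (PT2).  The lattice
-- filter {x | G(x) ∈ F′} is upward closed and misses c, so prelinearity makes the filter
-- generated by the (c → x) · (a → q), for x in it, proper; at a maximal filter F above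
-- it ⟦c⟧(F) ≤ R(F,F′) and R(F,F′) → ⟦a⟧(F) ≤ ⟦c → a⟧(F) = ⟦q ∨ a⟧(F) = q.
-- By (PT3) the natural relation of H is the converse of that of G, so the claims about H
-- are those about G for the converse relation.

module Submission where

open import Defs
open import Level using (Level; Lift; lift; lower; _⊔_) renaming (suc to lsuc)
open import Data.Empty using (⊥-elim)
open import Data.Product using (∃-syntax; _×_; _,_; proj₁; proj₂)
open import Data.Rational as ℚ using (ℚ; 0ℚ; 1ℚ; _+_; _-_; _<_; _≤_)
import Data.Rational.Properties as ℚ
open import Data.Rational.Solver using (module +-*-Solver)
open import Data.Sum using (_⊎_; inj₁; inj₂)
open import Function using (_⇔_; mk⇔)
open import Function.Construct.Composition using () renaming (_⇔-∘_ to infixr 8 _⇔-∘_)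
open import Relation.Binary using (Poset)
open import Relation.Binary.PropositionalEquality using (refl; subst)
open import Relation.Nullary using (¬_; yes; no)
open import Relation.Nullary.Decidable using (True; toWitness; fromWitness)
open import Relation.Unary using (Pred)

-- The real unit interval of cuts as an MV-algebra.

module _ {ℓ : Level} where
  open ℚ-Lemmas
  open +-*-Solver
  open 𝕀

  <-between : ∀ {p q r} → p < q → p < r → ∃[ m ] (p < m × m < q × m < r)
  <-between {p} {q} {r} p<q p<r with q ℚ.≤? r
  ... | yes q≤r = let (m , p<m , m<q) = ℚ.<-dense p<q in m , p<m , m<q , ℚ.<-≤-trans m<q q≤r
  ... | no  q≰r = let (m , p<m , m<r) = ℚ.<-dense p<r in m , p<m , ℚ.<-trans m<r (ℚ.≰⇒> q≰r) , m<r

  ~ᴵ-anti : (α β : 𝕀 ℓ) → α ≤ᴵ β → ~ᴵ β ≤ᴵ ~ᴵ α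
  ~ᴵ-anti α β α≤β (q , p<q , h) = q , p<q , λ k → h (α≤β k)

  ~ᴵ-involutive : EM → (α : 𝕀 ℓ) → ~ᴵ ~ᴵ α ≃ α
  ~ᴵ-involutive em α = to , from
    where
    to : ~ᴵ ~ᴵ α ≤ᴵ α
    to {p} (q , p<q , h) = by-contradiction em λ p⊀ → h
      (1ℚ - p , 0<⇒< (<⇒0< p<q) (solve 3 (λ p q o → q :- p := (o :- p) :- (o :- q)) refl p q 1ℚ) ,
       λ k → p⊀ (subst (_≺ α) (solve 2 (λ p o → o :- (o :- p) := p) refl p 1ℚ) k))

    from : α ≤ᴵ ~ᴵ ~ᴵ α
    from p≺ = let (q , p<q , q≺) = below-open α p≺ in
      q , p<q , λ (r , 1-q<r , h) → h (below-down α
        (0<⇒< (<⇒0< 1-q<r) (solve 3 (λ q r o → r :- (o :- q) := q :- (o :- r)) refl q r 1ℚ)) q≺)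

  ⊕ᴵ-comm : (α β : 𝕀 ℓ) → α ⊕ᴵ β ≤ᴵ β ⊕ᴵ α
  ⊕ᴵ-comm α β (p<1 , a , b , a≺ , b≺ , p<) = p<1 , b , a , b≺ , a≺ , subst (_ <_) (ℚ.+-comm a b) p<

  ⊕ᴵ-identityˡ : (α : 𝕀 ℓ) → fromℚ 0𝕀ℚ ⊕ᴵ α ≃ α
  ⊕ᴵ-identityˡ α = to , from
    where
    to : fromℚ 0𝕀ℚ ⊕ᴵ α ≤ᴵ α
    to {p} (_ , a , b , lift a<0 , b≺ , p<) = below-down α
      (ℚ.<-trans p< (subst (a + b <_) (ℚ.+-identityˡ b) (ℚ.+-monoˡ-< b a<0))) b≺

    from : α ≤ᴵ fromℚ 0𝕀ℚ ⊕ᴵ α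
    from {p} p≺ =
      let (q , p<q , q≺) = below-open α p≺
          (m , p<m , m<q) = ℚ.<-dense p<q
      in below-<1 α p≺ , m - q , q ,
         lift (0<⇒< (<⇒0< m<q) (solve 2 (λ m q → q :- m := con 0ℚ :- (m :- q)) refl m q)) , q≺ ,
         subst (p <_) (solve 2 (λ m q → m := (m :- q) :+ q) refl m q) p<m

  -- A rational v for the inner sum must lie above p - a′ and below both 1 and b + c. Only the
  -- truncation bound p - a′ < 1 can fail for the given a.
  ⊕ᴵ-assoc≤ : (α β γ : 𝕀 ℓ) → (α ⊕ᴵ β) ⊕ᴵ γ ≤ᴵ α ⊕ᴵ (β ⊕ᴵ γ)
  ⊕ᴵ-assoc≤ α β γ {p} (p<1 , u , c , (_ , a , b , a≺ , b≺ , u<a+b) , c≺ , p<u+c) =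
    let (a′ , a≤a′ , a′≺ , p-a′<1) = enlarge
        p-a′<b+c = 0<⇒< (0<+0≤ (0<+0< (<⇒0< p<u+c) (<⇒0< u<a+b)) (≤⇒0≤ a≤a′))
          (solve 6 (λ p u a b c a′ → (((u :+ c) :- p) :+ ((a :+ b) :- u)) :+ (a′ :- a) := (b :+ c) :- (p :- a′))
            refl p u a b c a′)
        (v , p-a′<v , v<1 , v<b+c) = <-between p-a′<1 p-a′<b+c
    in p<1 , a′ , v , a′≺ , (v<1 , b , c , b≺ , c≺ , v<b+c) ,
       0<⇒< (<⇒0< p-a′<v) (solve 3 (λ p a v → v :- (p :- a) := (a :+ v) :- p) refl p a′ v)
    where
    -- If a is so negative that p - a ≥ 1, a larger negative rational replaces it.
    enlarge : ∃[ a′ ] (a ≤ a′ × a′ ≺ α × p - a′ < 1ℚ)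
    enlarge with 1ℚ ℚ.≤? p - a
    ... | no  1≰ = a , ℚ.≤-refl , a≺ , ℚ.≰⇒> 1≰
    ... | yes 1≤ =
      let (m , p-1<m , m<0) = ℚ.<-dense {p - 1ℚ} {0ℚ}
            (0<⇒< (<⇒0< p<1) (solve 2 (λ p o → o :- p := con 0ℚ :- (p :- o)) refl p 1ℚ))
      in m , 0≤⇒≤ (0≤+0≤ (≤⇒0≤ 1≤) (≤⇒0≤ (ℚ.<⇒≤ p-1<m)))
               (solve 4 (λ p a m o → ((p :- a) :- o) :+ (m :- (p :- o)) := m :- a) refl p a m 1ℚ) ,
         below-neg α m<0 , 0<⇒< (<⇒0< p-1<m) (solve 3 (λ p m o → m :- (p :- o) := o :- (p :- m)) refl p m 1ℚ)

  -- The second inequality is the first for the reversed triple, conjugated by commutativity.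
  ⊕ᴵ-assoc : (α β γ : 𝕀 ℓ) → (α ⊕ᴵ β) ⊕ᴵ γ ≃ α ⊕ᴵ (β ⊕ᴵ γ)
  ⊕ᴵ-assoc α β γ = ⊕ᴵ-assoc≤ α β γ , λ h →
    ⊕ᴵ-comm γ (α ⊕ᴵ β) (⊕ᴵ-mono {ℓ} {γ} {γ} {β ⊕ᴵ α} {α ⊕ᴵ β} (λ k → k) (⊕ᴵ-comm β α)
      (⊕ᴵ-assoc≤ γ β α (⊕ᴵ-mono {ℓ} {β ⊕ᴵ γ} {γ ⊕ᴵ β} {α} {α} (⊕ᴵ-comm β γ) (λ k → k)
        (⊕ᴵ-comm α (β ⊕ᴵ γ) h))))

  <1⇒≺~0 : ∀ {p} → p < 1ℚ → p ≺ ~ᴵ fromℚ {ℓ} 0𝕀ℚ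
  <1⇒≺~0 p<1 = 1ℚ , p<1 , λ (lift 0<0) → ℚ.<-irrefl refl 0<0

  fromℚ0≤ : (α : 𝕀 ℓ) → fromℚ 0𝕀ℚ ≤ᴵ α
  fromℚ0≤ α (lift p<0) = below-neg α p<0

  ⊕ᴵ-zeroʳ : (α : 𝕀 ℓ) → α ⊕ᴵ (~ᴵ fromℚ 0𝕀ℚ) ≃ ~ᴵ fromℚ 0𝕀ℚ
  ⊕ᴵ-zeroʳ α = (λ h → <1⇒≺~0 (proj₁ h)) , λ h →
    ⊕ᴵ-mono {ℓ} {fromℚ 0𝕀ℚ} {α} {one} {one} (fromℚ0≤ α) (λ k → k) (proj₂ (⊕ᴵ-identityˡ one) h)
    where
    one : 𝕀 ℓ
    one = ~ᴵ fromℚ 0𝕀ℚ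

  module _ (em : EM) where
    open 𝕀-Lemmas em {ℓ}

    infixl 6 _∨ᴵ_
    _∨ᴵ_ : 𝕀 ℓ → 𝕀 ℓ → 𝕀 ℓ
    α ∨ᴵ β = (~ᴵ ((~ᴵ α) ⊕ᴵ β)) ⊕ᴵ β

    ∨ᴵ-ubʳ : (α β : 𝕀 ℓ) → β ≤ᴵ α ∨ᴵ β
    ∨ᴵ-ubʳ α β h = ⊕ᴵ-mono {ℓ} {fromℚ 0𝕀ℚ} {~ᴵ ((~ᴵ α) ⊕ᴵ β)} {β} {β} (fromℚ0≤ (~ᴵ ((~ᴵ α) ⊕ᴵ β))) (λ k → k)
      (proj₂ (⊕ᴵ-identityˡ β) h)

    -- α → (~ γ ⊕ β) reassociates to γ ⊕ ~ γ, where γ = ~ α ⊕ β.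
    ∨ᴵ-ubˡ : (α β : 𝕀 ℓ) → α ≤ᴵ α ∨ᴵ β
    ∨ᴵ-ubˡ α β = ⇒⇒≤ {α} {α ∨ᴵ β} λ p<1 →
      ⊕ᴵ-mono {ℓ} {~ᴵ α} {~ᴵ α} {β ⊕ᴵ (~ᴵ γ)} {(~ᴵ γ) ⊕ᴵ β} (λ k → k) (⊕ᴵ-comm β (~ᴵ γ))
        (⊕ᴵ-assoc≤ (~ᴵ α) β (~ᴵ γ) (⊕ᴵ-comm (~ᴵ γ) γ (≤⇒⇒ {γ} {γ} (λ k → k) p<1)))
      where
      γ : 𝕀 ℓ
      γ = (~ᴵ α) ⊕ᴵ β

    -- If q ≤ 0, then a is negative and p < b. Otherwise 1 - q is below the truncation at 1, so its
    -- absence from `(~ᴵ α) ⊕ᴵ β` keeps `~ᴵ α` at most 1 - (q + b), and α is at least q + b > p.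
    ∨ᴵ-lub : (α β γ : 𝕀 ℓ) → α ≤ᴵ γ → β ≤ᴵ γ → α ∨ᴵ β ≤ᴵ γ
    ∨ᴵ-lub α β γ α≤γ β≤γ {p} (_ , a , b , (q , a<q , h) , b≺ , p<a+b) with q ℚ.≤? 0ℚ
    ... | yes q≤0 = β≤γ (below-down β (ℚ.<-trans p<a+b
                      (subst (a + b <_) (ℚ.+-identityˡ b) (ℚ.+-monoˡ-< b (ℚ.<-≤-trans a<q q≤0)))) b≺)
    ... | no  q≰0 = α≤γ (proj₁ (~ᴵ-involutive em α)
        (q + b , ℚ.<-trans p<a+b (ℚ.+-monoˡ-< b a<q) , λ k →
          let (c , <c , c≺) = below-open (~ᴵ α) k in
          h ( 0<⇒< (ℚ.≰⇒> q≰0) (solve 2 (λ q o → q := o :- (o :- q)) refl q 1ℚ) , c , b , c≺ , b≺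
            , 0<⇒< (<⇒0< <c) (solve 4 (λ q b c o → c :- (o :- (q :+ b)) := (c :+ b) :- (o :- q)) refl q b c 1ℚ))))

    -- This is the Łukasiewicz axiom: its asymmetric formula computes a least upper bound.
    ∨ᴵ-comm≤ : (α β : 𝕀 ℓ) → α ∨ᴵ β ≤ᴵ β ∨ᴵ α
    ∨ᴵ-comm≤ α β = ∨ᴵ-lub α β (β ∨ᴵ α) (∨ᴵ-ubʳ β α) (∨ᴵ-ubˡ β α)

    -- The equality is lifted because MVAlgebra wants it at the level of the carrier.
    𝕀-mvAlgebra : MVAlgebra (lsuc ℓ)
    𝕀-mvAlgebra = record
      { raw = record
        { Carrier = 𝕀 ℓ ; _≈_ = λ α β → Lift (lsuc ℓ) (α ≃ β)
        ; _⊕_ = _⊕ᴵ_ ; ~_ = ~ᴵ_ ; 0# = fromℚ 0𝕀ℚ }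
      ; isCommutativeMonoid = record
        { isMonoid = record
          { isSemigroup = record
            { isMagma = record
              { isEquivalence = record
                { refl  = lift ((λ h → h) , (λ h → h))
                ; sym   = λ (lift (f , g)) → lift (g , f)
                ; trans = λ (lift (f , g)) (lift (f′ , g′)) → lift ((λ h → f′ (f h)) , (λ h → g (g′ h)))
                }
              ; ∙-cong = λ {α} {β} {γ} {δ} (lift (f , g)) (lift (f′ , g′)) →
                  lift (⊕ᴵ-mono {ℓ} {α} {β} {γ} {δ} f f′ , ⊕ᴵ-mono {ℓ} {β} {α} {δ} {γ} g g′)
              }
            ; assoc = λ α β γ → lift (⊕ᴵ-assoc α β γ)
            }
          ; identity = (λ α → lift (⊕ᴵ-identityˡ α)) ,
              λ α → lift ( (λ h → proj₁ (⊕ᴵ-identityˡ α) (⊕ᴵ-comm α (fromℚ 0𝕀ℚ) h))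
                         , (λ h → ⊕ᴵ-comm (fromℚ 0𝕀ℚ) α (proj₂ (⊕ᴵ-identityˡ α) h)))
          }
        ; comm = λ α β → lift (⊕ᴵ-comm α β , ⊕ᴵ-comm β α)
        }
      ; ~-cong       = λ {α} {β} (lift (f , g)) → lift (~ᴵ-anti β α g , ~ᴵ-anti α β f)
      ; ~-involutive = λ α → lift (~ᴵ-involutive em α)
      ; ⊕-zeroʳ      = λ α → lift (⊕ᴵ-zeroʳ α)
      ; łukasiewicz  = λ α β → lift (∨ᴵ-comm≤ α β , ∨ᴵ-comm≤ β α)
      }

    private module 𝕍 = MVAlgebra 𝕀-mvAlgebra

    ≤ᴵ⇒⊑ : (α β : 𝕀 ℓ) → α ≤ᴵ β → α 𝕍.⊑ β
    ≤ᴵ⇒⊑ α β α≤β = lift ((λ h → <1⇒≺~0 (proj₁ h)) ,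
                          λ h → ≤⇒⇒ {α} {β} α≤β (below-<1 (~ᴵ fromℚ 0𝕀ℚ) h))

    ⊑⇒≤ᴵ : (α β : 𝕀 ℓ) → α 𝕍.⊑ β → α ≤ᴵ β
    ⊑⇒≤ᴵ α β (lift (_ , g)) = ⇒⇒≤ {α} {β} λ p<1 → g (<1⇒≺~0 p<1)

    -- The cut of the rational 1 and `𝕍.1#`, the negation of the cut of 0, are different terms; both
    -- contain exactly the rationals below 1.
    ≃1ᴵ⇒1⊑ : (α : 𝕀 ℓ) → α ≃ 1ᴵ → 𝕍.1# 𝕍.⊑ α
    ≃1ᴵ⇒1⊑ α (_ , 1≤α) = ≤ᴵ⇒⊑ 𝕍.1# α λ h → 1≤α (lift (below-<1 𝕍.1# h))

    1⊑⇒≃1ᴵ : (α : 𝕀 ℓ) → 𝕍.1# 𝕍.⊑ α → α ≃ 1ᴵ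
    1⊑⇒≃1ᴵ α 1⊑α = (λ h → lift (below-<1 α h)) , (λ (lift p<1) → ⊑⇒≤ᴵ 𝕍.1# α 1⊑α (<1⇒≺~0 p<1))

-- Residuation laws up to given equations.

module Residuation {v} (V : MVAlgebra v) where
  open MVAlgebra V
  open MVProperties V

  ⇒-resp-~ : ∀ w s y z → w ≈ s ⊕ z → s ≈ ~ y → w ≈ y ⇒ z
  ⇒-resp-~ _ _ _ _ w≈s⊕z s≈~y = ≈-trans w≈s⊕z (⊕-congʳ s≈~y)

  ⇒-swap : ∀ w x y z → w ≈ y ⇒ z → x ⊑ w → y ⊑ x ⇒ z
  ⇒-swap _ _ _ _ w≈y⇒z x⊑w =
    curry (⊑-trans (⊑-reflexive (·-comm _ _)) (uncurry (⊑-trans x⊑w (⊑-reflexive w≈y⇒z))))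

  ⇒-antiˡ : ∀ w x y z → w ≈ x ⇒ z → x ⊑ y → y ⇒ z ⊑ w
  ⇒-antiˡ _ _ _ _ w≈x⇒z x⊑y = ⊑-trans (⇒-mono x⊑y ⊑-refl) (⊑-reflexive (≈-sym w≈x⇒z))

  -- By contraposition g ⇒ ~ h equals h ⇒ ~ g. This moves a bound on one natural relation to the
  -- relation of the adjoint operator.
  ⇒-contraˡ : ∀ w g n m h z → w ⊑ g ⇒ n → m ≈ ~ g → n ≈ ~ h → m ⊑ z → w ⊑ h ⇒ z
  ⇒-contraˡ _ _ _ _ h z w⊑g⇒n m≈~g n≈~h m⊑z = ⊑-trans w⊑g⇒n
    (⊑-trans (⊑-reflexive (⊕-cong (≈-sym m≈~g) n≈~h))
    (⊑-trans (⊕-monoˡ (~ h) m⊑z) (⊑-reflexive (⊕-comm z (~ h)))))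

-- Frame correspondence over an arbitrary MV-algebra.

module Frames {v} (V : MVAlgebra v) {a t} {A : Set a} {T : Set t}
              (⟦_⟧ : A → T → MVAlgebra.Carrier V) where
  open MVAlgebra V
  open MVProperties V

  _≼_ : A → A → Set (t ⊔ v)
  x ≼ y = ∀ s → ⟦ x ⟧ s ⊑ ⟦ y ⟧ s

  Reflexive Symmetric Transitive : (T → T → Carrier) → Set (t ⊔ v)
  Reflexive  R = ∀ s → 1# ⊑ R s s
  Symmetric  R = ∀ s t → R s t ⊑ R t s
  Transitive R = ∀ s t u → R s t · R t u ⊑ R s u

  -- `represents` is the hard half of ⟦G a⟧ t = ⋀ₛ (R s t ⇒ ⟦a⟧ s); the other half is `lower-bound`
  -- residuated. Infima appear through universal properties because `V` carries no infinitary ones.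
  record IsFrame (G : A → A) (R : T → T → Carrier) : Set (a ⊔ t ⊔ v) where
    field
      lower-bound : ∀ a s t → R s t ⊑ ⟦ G a ⟧ t ⇒ ⟦ a ⟧ s
      greatest    : ∀ {β} s t → (∀ a → β ⊑ ⟦ G a ⟧ t ⇒ ⟦ a ⟧ s) → β ⊑ R s t
      represents  : ∀ {β} a t → (∀ s → β ⊑ R s t ⇒ ⟦ a ⟧ s) → β ⊑ ⟦ G a ⟧ t

    ⟦G⟧·R⊑ : ∀ a s t → ⟦ G a ⟧ t · R s t ⊑ ⟦ a ⟧ s
    ⟦G⟧·R⊑ a s t = ⊑-trans (⊑-reflexive (·-comm _ _)) (uncurry (lower-bound a s t))

    reflexive⇔ : Reflexive R ⇔ (∀ x → G x ≼ x)
    reflexive⇔ = mk⇔ (λ rfl x s → 1⊑⇒≈ (⊑-trans (rfl s) (lower-bound x s s)))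
                     (λ Gx≼x s → greatest s s λ x → ⊑-reflexive (≈-sym (Gx≼x x s)))

    -- Representing first G x at u and then x at t reduces the forward goal to ⟦G x⟧ u · R t u · R s
    -- t ⊑ ⟦x⟧ s, where transitivity merges the two relation factors. Conversely, G (G x) is
    -- evaluated along R t u and then along R s t.
    transitive⇔ : Transitive R ⇔ (∀ x → G x ≼ G (G x))
    transitive⇔ = mk⇔
      (λ trn x u → represents (G x) u λ t → curry (represents x t λ s → curry
        (⊑-trans (⊑-reflexive (·-assoc _ _ _))
        (⊑-trans (·-mono ⊑-refl (⊑-trans (⊑-reflexive (·-comm _ _)) (trn s t u))) (⟦G⟧·R⊑ x s u)))))
      (λ Gx≼GGx s t u → greatest s u λ x → curry
        (⊑-trans (⊑-reflexive (·-assoc _ _ _))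
        (⊑-trans (·-mono ⊑-refl (⊑-trans (⊑-reflexive (·-comm _ _))
                   (⊑-trans (·-mono (Gx≼GGx x u) ⊑-refl) (⟦G⟧·R⊑ (G x) t u))))
        (⊑-trans (⊑-reflexive (·-comm _ _)) (⟦G⟧·R⊑ x s t)))))

  module Converse {G H R S} (frameG : IsFrame G R) (frameH : IsFrame H S)
                  (R⊑S : ∀ s t → R s t ⊑ S t s) (S⊑R : ∀ s t → S s t ⊑ R t s) where
    private
      module 𝐆 = IsFrame frameG
      module 𝐇 = IsFrame frameH

    -- Symmetry puts R and S below each other at the same pair, and representation turns this into a
    -- comparison of H and G. Conversely, R s t ⊑ S t s, and G x ≼ H x carries the bounds on S t s
    -- over to R t s.
    symmetric⇔ : Symmetric R ⇔ ((∀ x → H x ≼ G x) × (∀ x → G x ≼ H x))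
    symmetric⇔ = mk⇔
      (λ sym → (λ x t → 𝐆.represents x t λ s → curry
                  (⊑-trans (·-mono ⊑-refl (⊑-trans (sym s t) (R⊑S t s))) (𝐇.⟦G⟧·R⊑ x s t)))
             , (λ x t → 𝐇.represents x t λ s → curry
                  (⊑-trans (·-mono ⊑-refl (⊑-trans (S⊑R s t) (sym t s))) (𝐆.⟦G⟧·R⊑ x s t))))
      (λ (_ , G≼H) s t → 𝐆.greatest t s λ x → ⊑-trans (R⊑S s t)
        (⊑-trans (𝐇.lower-bound x t s) (⇒-mono (G≼H x s) ⊑-refl)))

    reflexive-converse : Reflexive R ⇔ Reflexive S
    reflexive-converse = mk⇔ (λ rfl s → ⊑-trans (rfl s) (R⊑S s s)) (λ rfl s → ⊑-trans (rfl s) (S⊑R s s))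

    transitive-converse : Transitive R ⇔ Transitive S
    transitive-converse = mk⇔
      (λ trn s t u → ⊑-trans (·-mono (S⊑R s t) (S⊑R t u))
        (⊑-trans (⊑-reflexive (·-comm _ _)) (⊑-trans (trn u t s) (R⊑S u s))))
      (λ trn s t u → ⊑-trans (·-mono (R⊑S s t) (R⊑S t u))
        (⊑-trans (⊑-reflexive (·-comm _ _)) (⊑-trans (trn u t s) (S⊑R u s))))

-- Extending proper filters to maximal ones by Zorn's lemma.

module MaximalFilterExtension (em : EM) (zorn : ZornsLemma) {ℓ} (𝔸 : MVAlgebra ℓ) where
  open MVAlgebra 𝔸
  open MVProperties 𝔸

  -- Excluded middle resizes propositions; the union of a chain of filters, which
  -- quantifies over all filters, is thereby again a predicate at level ℓ.
  Resize : ∀ {a} → Set a → Set ℓ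
  Resize P = Lift ℓ (True (em {P = P}))

  resize : ∀ {a} {P : Set a} → P → Resize P
  resize p = lift (fromWitness p)

  unresize : ∀ {a} {P : Set a} → Resize P → P
  unresize (lift t) = toWitness t

  module _ {K : Pred Carrier ℓ} (K-isFilter : IsFilter 𝔸 K) (K-proper : ¬ K 0#) where

    record ProperFilter : Set (lsuc ℓ) where
      field
        Mem      : Pred Carrier ℓ
        isFilter : IsFilter 𝔸 Mem
        proper   : ¬ Mem 0#
        extends  : ∀ {x} → K x → Mem x
      open IsFilter isFilter public

    open ProperFilter

    inclusion : Poset (lsuc ℓ) ℓ ℓ
    inclusion = record
      { Carrier = ProperFilter
      ; _≈_ = λ F F′ → (∀ x → Mem F x → Mem F′ x) × (∀ x → Mem F′ x → Mem F x)
      ; _≤_ = λ F F′ → ∀ x → Mem F x → Mem F′ x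
      ; isPartialOrder = record
        { isPreorder = record
          { isEquivalence = record
            { refl  = (λ _ m → m) , (λ _ m → m)
            ; sym   = λ (f , g) → g , f
            ; trans = λ (f , g) (f′ , g′) → (λ x m → f′ x (f x m)) , (λ x m → g x (g′ x m))
            }
          ; reflexive = proj₁
          ; trans = λ f g x m → g x (f x m)
          }
        ; antisym = _,_
        }
      }

    union : (C : Pred ProperFilter ℓ) → IsChain inclusion C → HasUpperBound inclusion C
    union C chain = record
      { Mem      = λ x → Resize (U x)
      ; isFilter = record
        { 1∈       = resize (inj₁ (IsFilter.1∈ K-isFilter))
        ; ·-closed = λ m m′ → resize (closed (unresize m) (unresize m′))
        ; ⊑-closed = λ m x⊑y → resize (up x⊑y (unresize m))
        }
      ; proper   = λ m → 0∉ (unresize m)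
      ; extends  = λ m → resize (inj₁ m)
      } , λ {F} F∈C x m → resize (inj₂ (F , F∈C , m))
      where
      U : Pred Carrier (lsuc ℓ)
      -- The summand `K x` provides the upper bound of the empty chain.
      U x = K x ⊎ (∃[ F ] (C F × Mem F x))

      closed : ∀ {x y} → U x → U y → U (x · y)
      closed (inj₁ m) (inj₁ m′) = inj₁ (IsFilter.·-closed K-isFilter m m′)
      closed (inj₁ m) (inj₂ (F , F∈C , m′)) = inj₂ (F , F∈C , ·-closed F (extends F m) m′)
      closed (inj₂ (F , F∈C , m)) (inj₁ m′) = inj₂ (F , F∈C , ·-closed F m (extends F m′))
      closed {x} {y} (inj₂ (F , F∈C , m)) (inj₂ (F′ , F′∈C , m′)) with chain F∈C F′∈C
      ... | inj₁ F⊆F′ = inj₂ (F′ , F′∈C , ·-closed F′ (F⊆F′ x m) m′)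
      ... | inj₂ F′⊆F = inj₂ (F , F∈C , ·-closed F m (F′⊆F y m′))

      up : ∀ {x y} → x ⊑ y → U x → U y
      up x⊑y (inj₁ m) = inj₁ (IsFilter.⊑-closed K-isFilter m x⊑y)
      up x⊑y (inj₂ (F , F∈C , m)) = inj₂ (F , F∈C , ⊑-closed F m x⊑y)

      0∉ : ¬ U 0#
      0∉ (inj₁ m) = K-proper m
      0∉ (inj₂ (F , _ , m)) = proper F m

    -- Maximality among the proper filters above `K` is maximality among all proper filters, since
    -- whatever contains `F` contains `K`.
    extend : ∃[ F ] (∀ {x} → K x → MaximalFilter.Mem {𝔸 = 𝔸} F x)
    extend with zorn inclusion union
    ... | F , isMaximal = record
      { Mem      = Mem F
      ; isFilter = isFilter F
      ; proper   = proper F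
      ; maximal  = λ F′ F′-isFilter F′-proper F⊆F′ {x} m →
          proj₁ (isMaximal {record { Mem = F′ ; isFilter = F′-isFilter ; proper = F′-proper
                                   ; extends = λ k → F⊆F′ (extends F k) }}
                           (λ _ m → F⊆F′ m)) x m
      } , extends F

-- Separation of points by maximal filters.

module Semisimple {ℓ} (𝔸 : MVAlgebra ℓ) (semisimple : IsSemisimple 𝔸) where
  open MVAlgebra 𝔸
  open MVProperties 𝔸
  open IsSemisimple semisimple

  module _ (i : Index) where
    private
      module 𝔹 = MVAlgebra (factor i)
      module 𝔹P = MVProperties (factor i)
      π : Carrier → 𝔹.Carrier
      π = proj i
    open IsMVHomomorphism (homomorphism i)

    π-1 : π 1# 𝔹.≈ 𝔹.1#
    π-1 = 𝔹.≈-trans (~-homo 0#) (𝔹.~-cong 0-homo)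

    π-⇒ : ∀ x y → π (x ⇒ y) 𝔹.≈ (π x 𝔹.⇒ π y)
    π-⇒ x y = 𝔹.≈-trans (⊕-homo (~ x) y) (𝔹P.⊕-congʳ (~-homo x))

    π-· : ∀ x y → π (x · y) 𝔹.≈ (π x 𝔹.· π y)
    π-· x y = 𝔹.≈-trans (~-homo _) (𝔹.~-cong (𝔹.≈-trans (⊕-homo _ _) (𝔹.⊕-cong (~-homo x) (~-homo y))))

    π-∨ : ∀ x y → π (x ∨ y) 𝔹.≈ (π x 𝔹.∨ π y)
    π-∨ x y = 𝔹.≈-trans (⊕-homo _ y) (𝔹P.⊕-congʳ (𝔹.≈-trans (~-homo _) (𝔹.~-cong (π-⇒ x y))))

    π-mono : ∀ {x y} → x ⊑ y → π x 𝔹.⊑ π y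
    π-mono {x} {y} x⊑y = 𝔹.≈-trans (𝔹.≈-sym (π-⇒ x y)) (𝔹.≈-trans (≈-cong x⊑y) π-1)

    kernel : Pred Carrier ℓ
    kernel x = π x 𝔹.≈ 𝔹.1#

    kernel-isFilter : IsFilter 𝔸 kernel
    kernel-isFilter = record
      { 1∈       = π-1
      ; ·-closed = λ {x} {y} p q → 𝔹.≈-trans (π-· x y)
          (𝔹.≈-trans (𝔹P.·-cong p q)
            (𝔹.~-cong (𝔹.≈-trans (𝔹.⊕-cong 𝔹P.~1≈0 𝔹P.~1≈0) (𝔹.⊕-identityˡ 𝔹.0#))))
      ; ⊑-closed = λ p x⊑y → 𝔹P.1⊑⇒≈ (𝔹P.⊑-trans (𝔹P.⊑-reflexive (𝔹.≈-sym p)) (π-mono x⊑y))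
      }

    module _ {F : Pred Carrier ℓ} (F-isFilter : IsFilter 𝔸 F) (F-proper : ¬ F 0#)
             (kernel⊆F : ∀ {x} → kernel x → F x) where
      open IsFilter F-isFilter

      image : Pred 𝔹.Carrier ℓ
      image b = ∃[ x ] (F x × π x 𝔹.≈ b)

      image-isFilter : IsFilter (factor i) image
      image-isFilter = record
        { 1∈       = 1# , 1∈ , π-1
        ; ·-closed = λ (x , x∈ , p) (y , y∈ , q) →
            x · y , ·-closed x∈ y∈ , 𝔹.≈-trans (π-· x y) (𝔹P.·-cong p q)
        -- A preimage y of c need not lie in F, but x ∨ y does, and it still projects to c.
        ; ⊑-closed = λ {b} {c} (x , x∈ , p) b⊑c → let (y , q) = surjective i c in
            x ∨ y , ⊑-closed x∈ ∨-ubˡ ,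
            𝔹.≈-trans (π-∨ x y) (𝔹.≈-trans
              (𝔹P.⊑⇒∨ (𝔹P.⊑-trans (𝔹P.⊑-reflexive p) (𝔹P.⊑-trans b⊑c (𝔹P.⊑-reflexive (𝔹.≈-sym q))))) q)
        }

      open FilterProperties (factor i) image-isFilter

      0∉image : ¬ image 𝔹.0#
      0∉image (x , x∈ , p) = F-proper (⊑-closed (·-closed (kernel⊆F ~x∈) x∈) ~x·x⊑0)
        where
        ~x∈ : kernel (~ x)
        ~x∈ = 𝔹.≈-trans (~-homo x) (𝔹.~-cong p)

      -- Simplicity makes the congruence of the image filter equality or total. The total one would
      -- put 0 into the image; under equality, every member of the image is 1.
      F⊆kernel : ∀ {x} → F x → kernel x
      F⊆kernel {x} x∈ with IsSimple.congruence (simple i) _∼_ ∼-isCongruence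
      ... | inj₁ ∼⇒≈ = ∼⇒≈ ( ⊑⇒∈ 𝔹P.⊑1
                            , ∈-≈ (𝔹.≈-sym (𝔹.≈-trans (𝔹P.⊕-congʳ 𝔹P.~1≈0) (𝔹.⊕-identityˡ _)))
                                (x , x∈ , 𝔹.≈-refl))
      ... | inj₂ total = ⊥-elim (0∉image
              (∈-≈ (𝔹.≈-trans (𝔹P.⊕-congʳ 𝔹P.~1≈0) (𝔹.⊕-identityˡ _)) (proj₁ (total 𝔹.1# 𝔹.0#))))

    kernel-maximal : MaximalFilter 𝔸
    kernel-maximal = record
      { Mem      = kernel
      ; isFilter = kernel-isFilter
      ; proper   = λ p → IsSimple.nontrivial (simple i) (𝔹.≈-trans (𝔹.≈-sym 0-homo) p)
      ; maximal  = λ _ → F⊆kernel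
      }

  ∈-all⇒≈1 : ∀ {x} → (∀ (F : MaximalFilter 𝔸) → MaximalFilter.Mem F x) → x ≈ 1#
  ∈-all⇒≈1 h = injective λ i →
    MVAlgebra.≈-trans (factor i) (h (kernel-maximal i)) (MVAlgebra.≈-sym (factor i) (π-1 i))

-- The representation of a modality by its natural relation.

module NaturalModality (em : EM) (zorn : ZornsLemma) {ℓ} (𝐀 : PavelkaAlgebra ℓ) where
  open PavelkaAlgebra 𝐀
  open MVProperties mvAlgebra
  open MaximalFilterExtension em zorn mvAlgebra
  open 𝕀 using (below-open; below-neg; below-<1)

  Spec : Set (lsuc ℓ)
  Spec = MaximalFilter mvAlgebra

  module At (F : Spec) where
    open MaximalFilter F public
    open FilterProperties mvAlgebra isFilter public hiding (linear)
    open QuotientEmbedding em 𝐀 F public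

  ⟦_⟧ : Carrier → Spec → 𝕀 ℓ
  ⟦ x ⟧ F = At.val F x

  𝕍 : MVAlgebra (lsuc ℓ)
  𝕍 = 𝕀-mvAlgebra em
  private
    module 𝕍 = MVAlgebra 𝕍

  open Frames 𝕍 ⟦_⟧
  open Residuation 𝕍

  ⟦⇒⟧ : ∀ x y F → ⟦ x ⇒ y ⟧ F 𝕍.≈ (⟦ x ⟧ F 𝕍.⇒ ⟦ y ⟧ F)
  ⟦⇒⟧ x y F = ⇒-resp-~ (⟦ x ⇒ y ⟧ F) (⟦ ~ x ⟧ F) (⟦ x ⟧ F) (⟦ y ⟧ F)
    (lift (At.val-⊕ F (~ x) y)) (lift (At.val-~ F x))

  ⊑⇒≼ : ∀ {x y} → x ⊑ y → x ≼ y
  ⊑⇒≼ {x} {y} x⊑y F = ≤ᴵ⇒⊑ em (⟦ x ⟧ F) (⟦ y ⟧ F) (At.val-mono F (At.⊑⇒∈ F x⊑y))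

  ≼⇒⊑ : IsSemisimple mvAlgebra → ∀ {x y} → x ≼ y → x ⊑ y
  ≼⇒⊑ semisimple {x} {y} x≼y = Semisimple.∈-all⇒≈1 mvAlgebra semisimple λ F →
    At.val-reflects F {x} {y} (⊑⇒≤ᴵ em (⟦ x ⟧ F) (⟦ y ⟧ F) (x≼y F))

  -- Write 1 as 1 · 1 and expand (v ∨ y) · (v ∨ z): every term except y · z is below v.
  ∨-· : ∀ {v y z} → 1# ⊑ v ∨ y → 1# ⊑ v ∨ z → 1# ⊑ v ∨ (y · z)
  ∨-· p q = ⊑-trans (⊑-reflexive (≈-sym (≈-trans (~-cong (≈-trans (⊕-congʳ ~1≈0) (⊕-identityˡ _))) (~-involutive 1#))))
    (⊑-trans (·-mono p q)
    (·-∨ (⊑-trans x·y⊑x ∨-ubˡ)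
      (⊑-trans (⊑-reflexive (·-comm _ _)) (·-∨ (⊑-trans x·y⊑x ∨-ubˡ) (⊑-trans (⊑-reflexive (·-comm _ _)) ∨-ubʳ)))))

  ∨-monoʳ : ∀ {v y z} → y ⊑ z → v ∨ y ⊑ v ∨ z
  ∨-monoʳ y⊑z = ∨-lub ∨-ubˡ (⊑-trans y⊑z ∨-ubʳ)

  R : (Carrier → Carrier) → Spec → Spec → 𝕀 ℓ
  R G F F′ = ⋀ λ a → (⟦ G a ⟧ F′) ⇒ᴵ (⟦ a ⟧ F)

  record IsModality (G : Carrier → Carrier) : Set ℓ where
    field
      cong   : ∀ {x y} → x ≈ y → G x ≈ G y
      ∧-homo : ∀ x y → G (x ∧ y) ≈ G x ∧ G y
      ⇒-homo : ∀ r x → const r ⇒ G x ≈ G (const r ⇒ x)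

  module _ {G : Carrier → Carrier} (isModality : IsModality G) where
    open IsModality isModality renaming (cong to G-cong; ∧-homo to G-∧; ⇒-homo to G-⇒)

    G-mono : ∀ {x y} → x ⊑ y → G x ⊑ G y
    G-mono {x} {y} x⊑y = ⊑-trans (⊑-reflexive (≈-trans (G-cong x≈x∧y) (G-∧ x y))) ∧-lbʳ
      where
      x≈x∧y : x ≈ x ∧ y
      x≈x∧y = ⊑-antisym (∧-glb ⊑-refl x⊑y) ∧-lbˡ

    -- (PT2) at the constant 0, where an implication is always 1.
    G-1 : 1# ⊑ G 1#
    G-1 = ⊑-trans (⊑-reflexive (≈-sym (const0⇒ (G 1#))))
      (⊑-trans (⊑-reflexive (G-⇒ 0𝕀ℚ 1#)) (⊑-reflexive (G-cong (const0⇒ 1#))))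
      where
      const0⇒ : ∀ x → const 0𝕀ℚ ⇒ x ≈ 1#
      const0⇒ x = ≈-trans (⊕-congʳ (~-cong const-0)) (⊕-zeroˡ x)

    module _ (F′ : Spec) (a : Carrier) (q : 𝕀ℚ) (q⇒Ga∉ : ¬ At.Mem F′ (const q ⇒ G a)) where
      private module F′ = At F′

      c : Carrier
      c = const q ⇒ a

      -- The first factor will give ⟦c⟧ ⊑ R, the second ⟦c ⇒ a⟧ ≤ q.
      u : Carrier → Carrier
      u x = (c ⇒ x) · (a ⇒ const q)

      -- Larger than the filter generated by the u x with G(x) ∈ F′: the union of their
      -- bipolars, which avoids powers of u x.
      K : Pred Carrier ℓ
      K y = ∃[ x ] (F′.Mem (G x) × (∀ v → 1# ⊑ v ∨ u x → 1# ⊑ v ∨ y))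

      K-isFilter : IsFilter mvAlgebra K
      K-isFilter = record
        { 1∈       = 1# , F′.⊑-closed F′.1∈ G-1 , λ v _ → ∨-ubʳ
        ; ·-closed = λ (x , Gx∈ , h) (y , Gy∈ , k) →
            -- The meet is the witness because (PT1) is about meets, not products; `u` at the meet
            -- is below both `u x` and `u y`.
            x ∧ y ,
            F′.∈-≈ (≈-trans (divisible (G x) (G y)) (≈-sym (G-∧ x y)))
              (F′.·-closed Gx∈ (F′.⊑-closed Gy∈ (curry x·y⊑x))) ,
            λ v p → ∨-· (h v (⊑-trans p (∨-monoʳ (u-mono ∧-lbˡ)))) (k v (⊑-trans p (∨-monoʳ (u-mono ∧-lbʳ))))
        ; ⊑-closed = λ (x , Gx∈ , h) y⊑z → x , Gx∈ , λ v p → ⊑-trans (h v p) (∨-monoʳ y⊑z)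
        }
        where
        u-mono : ∀ {x y} → x ⊑ y → u x ⊑ u y
        u-mono x⊑y = ·-mono (⇒-mono ⊑-refl x⊑y) ⊑-refl

      -- Test the bipolar condition for 0 at v = x ⇒ c. Prelinearity gives v ∨ (c ⇒ x) = 1, and also
      -- v ∨ (a ⇒ q) = 1 because q ⇒ a = c ⊑ v. Hence v = 1, so x ⊑ c and G c ∈ F′, a contradiction.
      K-proper : ¬ K 0#
      K-proper (x , Gx∈ , h) = q⇒Ga∉ (F′.∈-≈ (≈-sym (G-⇒ q a)) (F′.⊑-closed Gx∈ (G-mono x⊑c)))
        where
        x⇒c∨u : 1# ⊑ (x ⇒ c) ∨ u x
        x⇒c∨u = ∨-· (prelinear x c) (⊑-trans (prelinear (const q) a)
          (∨-lub (⊑-trans (curry x·y⊑x) ∨-ubˡ) ∨-ubʳ))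

        x⊑c : x ⊑ c
        x⊑c = 1⊑⇒≈ (⊑-trans (h (x ⇒ c) x⇒c∨u) (∨-lub ⊑-refl 0⊑))

      F : Spec
      F = proj₁ (extend K-isFilter K-proper)
      private module F = At F

      u∈F : ∀ {x} → F′.Mem (G x) → F.Mem (u x)
      u∈F {x} Gx∈ = proj₂ (extend K-isFilter K-proper) (x , Gx∈ , λ _ p → p)

      c⇒∈F : ∀ {x} → F′.Mem (G x) → F.Mem (c ⇒ x)
      c⇒∈F Gx∈ = F.⊑-closed (u∈F Gx∈) x·y⊑x

      -- By (PT2), a rational bound r ⇒ G x ∈ F′ becomes c ⇒ (r ⇒ x) ∈ F; then the premises are
      -- exchanged.
      ⟦G⟧≤⟦c⇒⟧ : ∀ x → ⟦ G x ⟧ F′ ≤ᴵ ⟦ c ⇒ x ⟧ F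
      ⟦G⟧≤⟦c⇒⟧ x (r , p<r , r⇒Gx∈) = r , p<r , F.⊑-closed (c⇒∈F (F′.∈-≈ (G-⇒ r x) r⇒Gx∈))
        (curry (curry (⊑-trans (⊑-reflexive (≈-trans (·-assoc _ _ _) (≈-trans (·-cong ≈-refl (·-comm _ _)) (≈-sym (·-assoc _ _ _)))))
          (⊑-trans (·-mono eval ⊑-refl) eval))))

      ⟦c⟧⊑R : ⟦ c ⟧ F 𝕍.⊑ R G F F′
      ⟦c⟧⊑R = ≤ᴵ⇒⊑ em (⟦ c ⟧ F) (R G F F′) (⋀-greatest (λ x → ⟦ G x ⟧ F′ 𝕍.⇒ ⟦ x ⟧ F) {⟦ c ⟧ F} λ x →
        ⊑⇒≤ᴵ em (⟦ c ⟧ F) (⟦ G x ⟧ F′ 𝕍.⇒ ⟦ x ⟧ F)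
          (⇒-swap (⟦ c ⇒ x ⟧ F) (⟦ G x ⟧ F′) (⟦ c ⟧ F) (⟦ x ⟧ F) (⟦⇒⟧ c x F)
            (≤ᴵ⇒⊑ em (⟦ G x ⟧ F′) (⟦ c ⇒ x ⟧ F) (⟦G⟧≤⟦c⇒⟧ x))))

      ⟦c⇒a⟧≤q : ⟦ c ⇒ a ⟧ F ≤ᴵ fromℚ q
      -- `c ⇒ a` unfolds to `const q ∨ a`, and a ⇒ q is in F as a factor of `u 1#`.
      ⟦c⇒a⟧≤q h = proj₁ (F.val-const q) (F.val-mono {c ⇒ a} {const q} (F.⊑-closed (F.⊑-closed (u∈F (F′.⊑-closed F′.1∈ G-1)) x·y⊑y)
        (curry (⊑-trans (⊑-reflexive (·-comm _ _)) (·-∨ x·y⊑x (⊑-trans (⊑-reflexive (·-comm _ _)) eval))))) h)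

      R⇒⟦a⟧≤q : R G F F′ 𝕍.⇒ ⟦ a ⟧ F ≤ᴵ fromℚ q
      R⇒⟦a⟧≤q h = ⟦c⇒a⟧≤q (⊑⇒≤ᴵ em (R G F F′ 𝕍.⇒ ⟦ a ⟧ F) (⟦ c ⇒ a ⟧ F)
        (⇒-antiˡ (⟦ c ⇒ a ⟧ F) (⟦ c ⟧ F) (R G F F′) (⟦ a ⟧ F) (⟦⇒⟧ c a F) ⟦c⟧⊑R) h)

    ⟦G⟧-represents : ∀ {β} a F′ → (∀ F → β ≤ᴵ R G F F′ 𝕍.⇒ ⟦ a ⟧ F) → β ≤ᴵ ⟦ G a ⟧ F′
    ⟦G⟧-represents {β} a F′ h {p} p≺β = by-contradiction em λ p⊀ →
      -- Openness gives q > p still below β. At the filter built for q the hypothesis bounds β by q,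
      -- so q ≺ β yields q < q.
      let (q , p<q , q≺β) = below-open β p≺β
          0≤q = ℚ.≤-trans (ℚ.≮⇒≥ λ p<0 → p⊀ (below-neg (⟦ G a ⟧ F′) p<0)) (ℚ.<⇒≤ p<q)
          q′ = mk𝕀ℚ q 0≤q (ℚ.<⇒≤ (below-<1 β q≺β))
          q∉ = λ m → p⊀ (q′ , p<q , m)
      in ℚ.<-irrefl refl (lower (R⇒⟦a⟧≤q F′ a q′ q∉ (h (F F′ a q′ q∉) q≺β)))

    isFrame : IsFrame G (R G)
    isFrame = record
      { lower-bound = λ a F F′ → ≤ᴵ⇒⊑ em (R G F F′) (⟦ G a ⟧ F′ 𝕍.⇒ ⟦ a ⟧ F)
          (⋀-lower (λ a → ⟦ G a ⟧ F′ 𝕍.⇒ ⟦ a ⟧ F) a)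
      ; greatest    = λ {β} F F′ h → ≤ᴵ⇒⊑ em β (R G F F′)
          (⋀-greatest (λ a → ⟦ G a ⟧ F′ 𝕍.⇒ ⟦ a ⟧ F) {β} λ a → ⊑⇒≤ᴵ em β (⟦ G a ⟧ F′ 𝕍.⇒ ⟦ a ⟧ F) (h a))
      ; represents  = λ {β} a F′ h → ≤ᴵ⇒⊑ em β (⟦ G a ⟧ F′)
          (⟦G⟧-represents {β} a F′ λ F → ⊑⇒≤ᴵ em β (R G F F′ 𝕍.⇒ ⟦ a ⟧ F) (h F))
      }

  -- Instantiates the infimum defining R G F F′ at the element ¬ H(a).
  adjoint⇒converse : ∀ {G H} → IsModality G → IsModality H → (∀ x → ~ G (~ H x) ⊑ x) →
                     ∀ F F′ → R G F F′ 𝕍.⊑ R H F′ F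
  adjoint⇒converse {G} {H} isG isH ~G~H⊑ F F′ = IsFrame.greatest (isFrame isH) {R G F F′} F′ F λ a →
    ⇒-contraˡ (R G F F′) (⟦ G (~ H a) ⟧ F′) (⟦ ~ H a ⟧ F) (⟦ ~ G (~ H a) ⟧ F′) (⟦ H a ⟧ F) (⟦ a ⟧ F′)
      (IsFrame.lower-bound (isFrame isG) (~ H a) F F′)
      (lift (At.val-~ F′ (G (~ H a)))) (lift (At.val-~ F (H a)))
      (⊑⇒≼ (~G~H⊑ a) F′)

-- The three correspondences for the natural time frame.

theorem13 : (em : EM) → ZornsLemma →
    ∀ {ℓ} (𝐀 : TensePavelkaAlgebra ℓ) → IsSemisimple (TensePavelkaAlgebra.mvAlgebra 𝐀) →
    let open TensePavelkaAlgebra 𝐀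
        open NaturalFrame em 𝐀 using (R)
    in
      ((FuzzyReflexive R ⇔ (∀ x → G x ⊑ x)) × (FuzzyReflexive R ⇔ (∀ x → H x ⊑ x)))
      × (FuzzySymmetric R ⇔ (∀ x → H x ≈ G x))
      × ((FuzzyTransitive R ⇔ (∀ x → G x ⊑ G (G x))) × (FuzzyTransitive R ⇔ (∀ x → H x ⊑ H (H x))))
theorem13 em zorn {ℓ} 𝐀 semisimple =
    ( pointwise ⇔-∘ 𝐆.reflexive⇔ ⇔-∘ fuzzyReflexive
    , pointwise ⇔-∘ 𝐇.reflexive⇔ ⇔-∘ reflexive-converse ⇔-∘ fuzzyReflexive )
  , equality ⇔-∘ symmetric⇔ ⇔-∘ fuzzySymmetric
  , ( pointwise ⇔-∘ 𝐆.transitive⇔ ⇔-∘ fuzzyTransitive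
    , pointwise ⇔-∘ 𝐇.transitive⇔ ⇔-∘ transitive-converse ⇔-∘ fuzzyTransitive )
  where
  open TensePavelkaAlgebra 𝐀
  open NaturalFrame em 𝐀 using (R)
  open NaturalModality em zorn pavelka using (𝕍; ⟦_⟧; IsModality; isFrame; ⊑⇒≼; ≼⇒⊑; adjoint⇒converse)
  open Frames 𝕍 ⟦_⟧
  open MVProperties mvAlgebra using (⊑-antisym; ⊑-reflexive)

  isG : IsModality G
  isG = record { cong = G-cong ; ∧-homo = G-∧ ; ⇒-homo = G-⇒ }

  isH : IsModality H
  isH = record { cong = H-cong ; ∧-homo = H-∧ ; ⇒-homo = H-⇒ }

  -- `R` unfolds to the relation of this frame, as the embedding chosen for each quotient is `val`.
  module 𝐆 = IsFrame (isFrame isG)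
  module 𝐇 = IsFrame (isFrame isH)
  open Converse (isFrame isG) (isFrame isH)
    (adjoint⇒converse isG isH ~G~H⊑) (adjoint⇒converse isH isG ~H~G⊑)

  pointwise : {f g : Carrier → Carrier} → (∀ x → f x ≼ g x) ⇔ (∀ x → f x ⊑ g x)
  pointwise = mk⇔ (λ h x → ≼⇒⊑ semisimple (h x)) (λ h x → ⊑⇒≼ (h x))

  equality : ((∀ x → H x ≼ G x) × (∀ x → G x ≼ H x)) ⇔ (∀ x → H x ≈ G x)
  equality = mk⇔
    (λ (H≼G , G≼H) x → ⊑-antisym (≼⇒⊑ semisimple (H≼G x)) (≼⇒⊑ semisimple (G≼H x)))
    (λ H≈G → (λ x → ⊑⇒≼ (⊑-reflexive (H≈G x))) , (λ x → ⊑⇒≼ (⊑-reflexive (≈-sym (H≈G x)))))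

  fuzzyReflexive : FuzzyReflexive R ⇔ Reflexive R
  fuzzyReflexive = mk⇔ (λ rfl F → ≃1ᴵ⇒1⊑ em (R F F) (rfl F)) (λ rfl F → 1⊑⇒≃1ᴵ em (R F F) (rfl F))

  fuzzySymmetric : FuzzySymmetric R ⇔ Symmetric R
  fuzzySymmetric = mk⇔ to from
    where
    to : FuzzySymmetric R → Symmetric R
    to sym F F′ = ≤ᴵ⇒⊑ em (R F F′) (R F′ F) (proj₁ (sym F F′))

    from : Symmetric R → FuzzySymmetric R
    from sym F F′ = ⊑⇒≤ᴵ em (R F F′) (R F′ F) (sym F F′) , ⊑⇒≤ᴵ em (R F′ F) (R F F′) (sym F′ F)

  fuzzyTransitive : FuzzyTransitive R ⇔ Transitive R
  fuzzyTransitive = mk⇔ to from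
    where
    to : FuzzyTransitive R → Transitive R
    to trn F₁ F₂ F₃ = ≤ᴵ⇒⊑ em (R F₁ F₂ ·ᴵ R F₂ F₃) (R F₁ F₃) (trn F₁ F₂ F₃)

    from : Transitive R → FuzzyTransitive R
    from trn F₁ F₂ F₃ = ⊑⇒≤ᴵ em (R F₁ F₂ ·ᴵ R F₂ F₃) (R F₁ F₃) (trn F₁ F₂ F₃)
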